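{- Let $\phi=\frac{1+\sqrt5}2$ and let $m\ge1$ be an integer. For scheduling with uncertain processing times on $m$ machines with the objective of minimizing the total completion time, the algorithm $(\alpha,\beta)$-PCPM with $\alpha=\phi$ and $\beta=\frac{\phi+\sqrt{5\phi+1}}2\le 2.31652$ has competitive ratio at most $$\frac{\phi+\sqrt{5\phi+1}}2\left(\frac12+\frac1{2m}\right)+\phi\left(1-\frac1m\right).$$ As $m$ tends to infinity, this bound tends to a value that is at most $2.77630$.
   Context: Problem. There are $n$ jobs, all available at time $0$, and $m$ identical machines, each of which runs one task at a time. Job $j$ has a testing time $t_j\ge 0$, an upper limit $u_j\ge 0$, and a real processing time $p_j\in[0,u_j]$. A job may be executed untested, which takes $u_j$ time units, or it may be tested (taking $t_j$ time units) and afterwards, once the test is finished, executed in $p_j$ time units; other tasks may run between the test and the execution, and the test and the execution of a job may be on different machines. The completion time of a job is the time at which its execution (or execution-untested) ends, and the cost of a schedule is the sum of the completion times of all jobs. An online algorithm knows all $t_j,u_j$ from the start, but learns $p_j$ only when the test of $j$ is finished. $\mathrm{OPT}$ knows all $p_j$ in advance (but must still test $j$ in order to run it in time $p_j$), and its cost is the minimum cost of any schedule. The competitive ratio of an online algorithm $A$ is the smallest $c$ such that $\mathrm{cost}(A)\le c\cdot\mathrm{cost}(\mathrm{OPT})$ on all instances. Algorithm $(\alpha,\beta)$-PCPM. Maintain a priority queue of tasks, smaller weight meaning higher priority (ties broken arbitrarily). Initially, for each job $j$: if $u_j\ge\alpha t_j$, insert a testing task of weight $\beta t_j$; otherwise insert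 an execution-untested task of weight $u_j$. All machines are idle at time $0$. Whenever a machine becomes idle: if the task it has just finished was the testing task of a job $i$, insert the execution task of $i$ (of duration $p_i$) with weight $t_i+p_i$ into the queue; then extract a task of smallest weight from the queue (if it is nonempty) and run it, without interruption, on this machine. -}

module Defs where

open import Level using (Level; _⊔_) renaming (suc to lsuc)
open import Algebra.Bundles using (CommutativeRing)
open import Data.Fin.Base using (Fin)
open import Data.List.Base using (List; []; _∷_; _++_; map; allFin)
open import Data.List.Relation.Binary.Permutation.Propositional using (_↭_)
open import Data.List.Relation.Unary.All using (All)
open import Data.Maybe.Base using (Maybe; just; nothing)
open import Data.Nat.Base as ℕ using (ℕ)
open import Data.Product.Base using (∃; _×_; _,_)
open import Data.Sum.Base using (_⊎_)
open import Data.Vec.Base using (Vec; lookup; replicate; _[_]≔_)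
open import Relation.Binary.Core using (Rel)
open import Relation.Binary.Construct.Closure.ReflexiveTransitive using (Star)
open import Relation.Binary.PropositionalEquality.Core using (_≡_; _≢_)
open import Relation.Binary.Structures using (IsDecTotalOrder)
open import Relation.Nullary.Decidable.Core using (yes; no)
open import Relation.Nullary.Negation.Core using (¬_)
open import Relation.Unary using (Pred)
import Algebra.Properties.Semiring.Mult as SemiringMult
import Algebra.Properties.Semiring.Sum as SemiringSum
import Relation.Binary.Construct.NonStrictToStrict as NonStrictToStrict

-- The real numbers, characterised classically (up to isomorphism) as the
-- Dedekind-complete linearly ordered field.  Classically `archimedean` follows
-- from `supremum`; it is listed because its witness n does not follow
-- constructively.  The value of 0# ⁻¹ is unspecified.

record RealField c ℓ₁ ℓ₂ : Set (lsuc (c ⊔ ℓ₁ ⊔ ℓ₂)) where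
  infix  4 _≤_
  infix  9 _⁻¹
  infixl 7 _/_

  field
    commutativeRing : CommutativeRing c ℓ₁

  open CommutativeRing commutativeRing public
  open SemiringSum semiring public using (sum)

  field
    _≤_             : Rel Carrier ℓ₂
    isDecTotalOrder : IsDecTotalOrder _≈_ _≤_
    _⁻¹             : Carrier → Carrier

  open IsDecTotalOrder isDecTotalOrder public using (_≤?_)
  open NonStrictToStrict _≈_ _≤_ public using (_<_)

  _/_ : Carrier → Carrier → Carrier
  x / y = x * y ⁻¹

  fromℕ : ℕ → Carrier
  fromℕ n = SemiringMult._×_ semiring n 1#

  UpperBound : ∀ {ℓ} → Pred Carrier ℓ → Pred Carrier (c ⊔ ℓ₂ ⊔ ℓ)
  UpperBound P b = ∀ x → P x → x ≤ b

  field
    0≉1         : ¬ 0# ≈ 1#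
    ⁻¹-inverseʳ : ∀ x → ¬ x ≈ 0# → x * x ⁻¹ ≈ 1#
    +-monoˡ-≤   : ∀ z {x y} → x ≤ y → x + z ≤ y + z
    *-nonNeg    : ∀ {x y} → 0# ≤ x → 0# ≤ y → 0# ≤ x * y
    archimedean : ∀ x → ∃ λ n → x ≤ fromℕ n
    supremum    : (P : Pred Carrier (c ⊔ ℓ₁ ⊔ ℓ₂)) → ∃ P → ∃ (UpperBound P) →
                  ∃ λ s → UpperBound P s × (∀ b → UpperBound P b → s ≤ b)

module Analysis {c ℓ₁ ℓ₂} (ℝ : RealField c ℓ₁ ℓ₂) where
  open RealField ℝ

  IsSqrt : Carrier → Carrier → Set (ℓ₁ ⊔ ℓ₂)
  IsSqrt a r = 0# ≤ r × r * r ≈ a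

  -- decimal k (d₁ ∷ d₂ ∷ … ∷ []) is k.d₁d₂…

  0·_ : List ℕ → Carrier
  0· []       = 0#
  0· (d ∷ ds) = (fromℕ d + 0· ds) / fromℕ 10

  decimal : ℕ → List ℕ → Carrier
  decimal k ds = fromℕ k + 0· ds

  TendsTo : (ℕ → Carrier) → Carrier → Set (c ⊔ ℓ₁ ⊔ ℓ₂)
  TendsTo f L = ∀ ε → 0# < ε → ∃ λ N → ∀ m → N ℕ.≤ m →
                L - ε < f m × f m < L + ε

module Scheduling {c ℓ₁ ℓ₂} (ℝ : RealField c ℓ₁ ℓ₂) where
  open RealField ℝ

  record Instance (n : ℕ) : Set (c ⊔ ℓ₂) where
    field
      t u p : Fin n → Carrier
      0≤t   : ∀ j → 0# ≤ t j
      0≤u   : ∀ j → 0# ≤ u j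
      0≤p   : ∀ j → 0# ≤ p j
      p≤u   : ∀ j → p j ≤ u j

  data Task (n : ℕ) : Set where
    untested test exec : Fin n → Task n

  duration : ∀ {n} → Instance n → Task n → Carrier
  duration I (untested j) = Instance.u I j
  duration I (test j)     = Instance.t I j
  duration I (exec j)     = Instance.p I j

  record Slot (m : ℕ) : Set c where
    constructor slot
    field
      machine : Fin m
      start   : Carrier

  open Slot public

  data Plan (m : ℕ) : Set c where
    runUntested : Slot m → Plan m
    testThenRun : (testSlot execSlot : Slot m) → Plan m

  Schedule : ℕ → ℕ → Set c
  Schedule n m = Fin n → Plan m

  data Scheduled {n m} (σ : Schedule n m) : Task n → Slot m → Set c where
    untested : ∀ {j s}   → σ j ≡ runUntested s    → Scheduled σ (untested j) s
    test     : ∀ {j s s′} → σ j ≡ testThenRun s s′ → Scheduled σ (test j) s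
    exec     : ∀ {j s s′} → σ j ≡ testThenRun s s′ → Scheduled σ (exec j) s′

  record Feasible {n m} (I : Instance n) (σ : Schedule n m) : Set (c ⊔ ℓ₂) where
    open Instance I
    field
      0≤start     : ∀ {x s} → Scheduled σ x s → 0# ≤ start s
      testFirst   : ∀ {j s s′} → σ j ≡ testThenRun s s′ →
                    start s + t j ≤ start s′
      oneAtATime  : ∀ {x y s s′} → Scheduled σ x s → Scheduled σ y s′ →
                    x ≢ y → machine s ≡ machine s′ →
                    start s + duration I x ≤ start s′ ⊎
                    start s′ + duration I y ≤ start s

  completion : ∀ {n m} → Instance n → Schedule n m → Fin n → Carrier
  completion I σ j with σ j
  ... | runUntested s   = start s + Instance.u I j
  ... | testThenRun _ s = start s + Instance.p I j

  cost : ∀ {n m} → Instance n → Schedule n m → Carrier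
  cost I σ = sum (completion I σ)

  Optimal : ∀ {n m} → Instance n → Schedule n m → Set (c ⊔ ℓ₂)
  Optimal {n} {m} I σ =
    Feasible I σ × (∀ (σ′ : Schedule n m) → Feasible I σ′ → cost I σ ≤ cost I σ′)

  -- An algorithm is given by the schedules it may produce on each instance;
  -- there may be several because ties are broken arbitrarily.

  Algorithm : ℕ → (ℓ : Level) → Set (c ⊔ ℓ₂ ⊔ lsuc ℓ)
  Algorithm m ℓ = ∀ {n} → Instance n → Schedule n m → Set ℓ

  CompetitiveRatioAtMost : ∀ {m ℓ} → Carrier → Algorithm m ℓ → Set (c ⊔ ℓ₂ ⊔ ℓ)
  CompetitiveRatioAtMost {m} C A =
    ∀ {n} (I : Instance n) (σ opt : Schedule n m) →
    A I σ → Optimal I opt → cost I σ ≤ C * cost I opt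

  module _ (α β : Carrier) where

    weight : ∀ {n} → Instance n → Task n → Carrier
    weight I (untested j) = Instance.u I j
    weight I (test j)     = β * Instance.t I j
    weight I (exec j)     = Instance.t I j + Instance.p I j

    initialTask : ∀ {n} → Instance n → Fin n → Task n
    initialTask I j with α * Instance.t I j ≤? Instance.u I j
    ... | yes _ = test j
    ... | no  _ = untested j

    -- `until τ x`: the machine becomes idle at time τ, having then just finished
    -- the task x (nothing at time 0, when no task has been run yet).
    -- `stopped`: the machine became idle and found the queue empty.  It never
    -- has to be woken up: a machine inserts at most one task when it becomes
    -- idle and extracts one at once, so an empty queue stays empty.

    data Machine (n : ℕ) : Set c where
      until   : Carrier → Maybe (Task n) → Machine n
      stopped : Machine n

    -- The queue is a list considered up to permutation.

    State : ℕ → ℕ → Set c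
    State n m = Vec (Machine n) m × List (Task n)

    initial : ∀ {n m} → Instance n → State n m
    initial {n} {m} I =
      replicate m (until 0# nothing) , map (initialTask I) (allFin n)

    insertAfter : ∀ {n} → Maybe (Task n) → List (Task n) → List (Task n)
    insertAfter (just (test i)) q = exec i ∷ q
    insertAfter _               q = q

    NextIdle : ∀ {n m} → Vec (Machine n) m → Fin m → Carrier → Maybe (Task n) →
               Set (c ⊔ ℓ₂)
    NextIdle ms k τ x = lookup ms k ≡ until τ x ×
                        (∀ k′ τ′ x′ → lookup ms k′ ≡ until τ′ x′ → τ ≤ τ′)

    -- One step handles the next machine becoming idle; machines becoming idle
    -- simultaneously are handled one after the other in any order.  A started
    -- task must be started exactly where and when σ says, so a complete run
    -- determines σ.

    data Step {n m} (I : Instance n) (σ : Schedule n m) :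
              Rel (State n m) (c ⊔ ℓ₂) where

      run : ∀ {ms q k τ x y rest} →
            NextIdle ms k τ x →
            insertAfter x q ↭ y ∷ rest →
            All (λ z → weight I y ≤ weight I z) rest →
            Scheduled σ y (slot k τ) →
            Step I σ (ms , q)
                     (ms [ k ]≔ until (τ + duration I y) (just y) , rest)

      stop : ∀ {ms q k τ x} →
             NextIdle ms k τ x →
             insertAfter x q ≡ [] →
             Step I σ (ms , q) (ms [ k ]≔ stopped , [])

    PCPM : ∀ {m} → Algorithm m (c ⊔ ℓ₂)
    PCPM {m} I σ = Star (Step I σ) (initial I) (replicate m stopped , [])

{-# OPTIONS --safe #-}
module Submission where

{-
Let q_j = min(u_j, t_j + p_j), P = Σ q_j and E = Σ_{i,j} min(q_i, q_j).

Optimum: 2m·OPT ≥ E + mP.  For every θ ≥ 0, a set S of jobs has total size at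
most mθ + Σ_{j∈S} (C_j − θ)⁺, because work before θ is limited by the machines
and work after θ by the fact that a job never runs in parallel with itself.
Choosing θ well, the m largest completion times among S sum up to at least the
total size of S.  Apply this to the sets of the first 1, 2, …, n jobs to finish;
the m − 1 sums of fewer than m of the largest completion times are handled by
Chebyshev's sum inequality.

Algorithm: 2m·ALG ≤ 2(m−1)φP + βP + βE.  Consider the moment at which the
execution of a tested job j is inserted.  Either all tasks started so far have
weight at most t_j + p_j, and then this remains so until the execution starts;
or the queue contains no other task of weight at most t_j + p_j, and then the
execution starts at once.  In either case the job is delayed only by
tasks started before a single event, the start of its execution or of its test,
and all of them are at most as heavy as the task started there.  The delays that
two jobs inflict on each other then sum up to at most β·min(q_i, q_j); the
critical case is where β² = φ(β + 1) is needed.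

The bound follows from both estimates together with P ≤ OPT and β ≤ 2φ.
-}

open import Defs
open import Data.Bool.Base using (if_then_else_)
open import Data.Fin.Base using (Fin; zero; suc)
import Data.Fin.Properties as Finₚ
open import Data.List.Base using (List; []; _∷_; _++_; length; map; concatMap; take; allFin; tabulate)
open import Data.List.Membership.Propositional using (_∈_; _∉_)
import Data.List.Membership.Propositional.Properties as ∈ₚ
import Data.List.Properties as Listₚ
import Data.List.Relation.Binary.Disjoint.Propositional as List
open import Data.List.Relation.Binary.Permutation.Propositional as ↭
  using (_↭_; ↭-sym; ↭-trans; ↭-refl; ↭-reflexive; ↭⇒↭ₛ)
import Data.List.Relation.Binary.Permutation.Propositional.Properties as ↭ₚ
import Data.List.Relation.Binary.Permutation.Setoid.Properties as ↭ₛ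
open import Data.List.Relation.Unary.All as All using (All; []; _∷_)
import Data.List.Relation.Unary.All.Properties as Allₚ
open import Data.List.Relation.Unary.AllPairs as AllPairs using (AllPairs; []; _∷_)
import Data.List.Relation.Unary.AllPairs.Properties as AllPairsₚ
open import Data.List.Relation.Unary.Any using (here; there)
import Data.List.Relation.Unary.Linked.Properties as Linkedₚ
open import Data.List.Relation.Unary.Unique.Propositional using (Unique)
import Data.List.Relation.Unary.Unique.Propositional.Properties as Uniqueₚ
import Data.List.Sort as Sort
open import Data.Maybe.Base using (Maybe; just; nothing)
open import Data.Nat.Base as ℕ using (ℕ; zero; suc; NonZero)
import Data.Nat.Properties as ℕₚ
open import Data.Product.Base using (∃; _×_; _,_; proj₁; proj₂)
open import Data.Sum.Base using (_⊎_; inj₁; inj₂; [_,_]′)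
open import Data.Unit.Base using (tt)
open import Data.Vec.Base using (Vec; []; _∷_; lookup; replicate; _[_]≔_)
import Data.Vec.Properties as Vecₚ
open import Function.Base using (_∘_; id; flip)
open import Level using (0ℓ; _⊔_)
open import Relation.Binary.Bundles using (DecTotalOrder; Poset)
open import Relation.Binary.Core using (Rel)
open import Relation.Binary.Construct.Closure.ReflexiveTransitive using (Star; ε; _◅_)
import Relation.Binary.Construct.Flip.EqAndOrd as Flip
import Relation.Binary.Construct.On as On
import Relation.Binary.PropositionalEquality as ≡
open ≡ using (_≡_; _≢_)
import Relation.Binary.Properties.DecTotalOrder as DecTotalOrderProperties
import Relation.Binary.Reasoning.PartialOrder as PosetReasoning
import Relation.Binary.Reasoning.Setoid as SetoidReasoning
open import Relation.Binary.Structures using (IsDecTotalOrder)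
open import Relation.Nullary.Decidable.Core using (yes; no; does)
open import Relation.Nullary.Negation.Core using (¬_; contradiction)
open import Relation.Unary using (Pred)
import Algebra.Properties.Ring as RingProperties
import Algebra.Properties.Semiring.Mult as SemiringMult
import Algebra.Properties.Semiring.Sum as SemiringSum
import Algebra.Solver.Ring.NaturalCoefficients.Default as NatSolver

-- Arithmetic in a linearly ordered field.

module OrderedField {c ℓ₁ ℓ₂} (ℝ : RealField c ℓ₁ ℓ₂) where
  open RealField ℝ hiding (zero)
  open NatSolver commutativeSemiring public
    using (solve; _:=_; _:+_; _:*_; con)
  open IsDecTotalOrder isDecTotalOrder public
    using (≤-respˡ-≈; ≤-respʳ-≈)
    renaming (refl to ≤-refl; trans to ≤-trans; antisym to ≤-antisym;
              reflexive to ≤-reflexive; total to ≤-total)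

  decTotalOrder : DecTotalOrder c ℓ₁ ℓ₂
  decTotalOrder = record { isDecTotalOrder = isDecTotalOrder }

  poset : Poset c ℓ₁ ℓ₂
  poset = DecTotalOrder.poset decTotalOrder

  module ≤R = PosetReasoning poset

  open DecTotalOrderProperties decTotalOrder public using (≰⇒>)
  open RingProperties ring using (-‿distribˡ-*; -‿involutive)

  ≰⇒≥ : ∀ {x y} → ¬ x ≤ y → y ≤ x
  ≰⇒≥ {x} {y} x≰y with ≤-total x y
  ... | inj₁ x≤y = contradiction x≤y x≰y
  ... | inj₂ y≤x = y≤x

  <⇒≱ : ∀ {x y} → x < y → ¬ y ≤ x
  <⇒≱ (x≤y , x≉y) y≤x = x≉y (≤-antisym x≤y y≤x)

  ≤-<-trans : ∀ {x y z} → x ≤ y → y < z → x < z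
  ≤-<-trans x≤y (y≤z , y≉z) = ≤-trans x≤y y≤z ,
    λ x≈z → y≉z (≤-antisym y≤z (≤-respˡ-≈ x≈z x≤y))

  <-≤-trans : ∀ {x y z} → x < y → y ≤ z → x < z
  <-≤-trans (x≤y , x≉y) y≤z = ≤-trans x≤y y≤z ,
    λ x≈z → x≉y (≤-antisym x≤y (≤-respʳ-≈ (sym x≈z) y≤z))

  +-monoʳ-≤ : ∀ z {x y} → x ≤ y → z + x ≤ z + y
  +-monoʳ-≤ z x≤y = ≤-respˡ-≈ (+-comm _ z) (≤-respʳ-≈ (+-comm _ z) (+-monoˡ-≤ z x≤y))

  +-mono-≤ : ∀ {w x y z} → w ≤ x → y ≤ z → w + y ≤ x + z
  +-mono-≤ {x = x} {y = y} w≤x y≤z = ≤-trans (+-monoˡ-≤ y w≤x) (+-monoʳ-≤ x y≤z)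

  +-nonNeg : ∀ {x y} → 0# ≤ x → 0# ≤ y → 0# ≤ x + y
  +-nonNeg 0≤x 0≤y = ≤-respˡ-≈ (+-identityˡ 0#) (+-mono-≤ 0≤x 0≤y)

  x-y+y≈x : ∀ x y → (x - y) + y ≈ x
  x-y+y≈x x y = trans (+-assoc x (- y) y)
    (trans (+-congˡ (-‿inverseˡ y)) (+-identityʳ x))

  x+y-y≈x : ∀ x y → (x + y) - y ≈ x
  x+y-y≈x x y = trans (+-assoc x y (- y))
    (trans (+-congˡ (-‿inverseʳ y)) (+-identityʳ x))

  +-cancelʳ-≤ : ∀ z {x y} → x + z ≤ y + z → x ≤ y
  +-cancelʳ-≤ z {x} {y} h =
    ≤-respˡ-≈ (x+y-y≈x x z) (≤-respʳ-≈ (x+y-y≈x y z) (+-monoˡ-≤ (- z) h))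

  +-cancelʳ-≈ : ∀ z {x y} → x + z ≈ y + z → x ≈ y
  +-cancelʳ-≈ z {x} {y} h =
    trans (sym (x+y-y≈x x z)) (trans (+-congʳ h) (x+y-y≈x y z))

  x≤x+y : ∀ x {y} → 0# ≤ y → x ≤ x + y
  x≤x+y x 0≤y = ≤-respˡ-≈ (+-identityʳ x) (+-monoʳ-≤ x 0≤y)

  x≤y+x : ∀ x {y} → 0# ≤ y → x ≤ y + x
  x≤y+x x 0≤y = ≤-respʳ-≈ (+-comm x _) (x≤x+y x 0≤y)

  -- Reduces a linear inequality to an identity without subtraction, which is
  -- within the reach of the semiring solver.
  linear : ∀ {x y} a b → x ≤ y → a + y ≈ b + x → a ≤ b
  linear {x} {y} a b x≤y eq = +-cancelʳ-≤ x
    (≤-trans (+-monoʳ-≤ a x≤y) (≤-reflexive eq))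

  x≤y⇒0≤y-x : ∀ {x y} → x ≤ y → 0# ≤ y - x
  x≤y⇒0≤y-x {x} {y} x≤y = +-cancelʳ-≤ x
    (≤-respˡ-≈ (sym (+-identityˡ x)) (≤-respʳ-≈ (sym (x-y+y≈x y x)) x≤y))

  *-monoˡ-≤ : ∀ {z x y} → 0# ≤ z → x ≤ y → z * x ≤ z * y
  *-monoˡ-≤ {z} {x} {y} 0≤z x≤y =
    ≤-respˡ-≈ (+-identityˡ _) (≤-respʳ-≈ eq (+-monoˡ-≤ (z * x) (*-nonNeg 0≤z (x≤y⇒0≤y-x x≤y))))
    where
    eq : z * (y - x) + z * x ≈ z * y
    eq = trans (sym (distribˡ z (y - x) x)) (*-congˡ (x-y+y≈x y x))

  *-monoʳ-≤ : ∀ {z x y} → 0# ≤ z → x ≤ y → x * z ≤ y * z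
  *-monoʳ-≤ 0≤z x≤y =
    ≤-respˡ-≈ (*-comm _ _) (≤-respʳ-≈ (*-comm _ _) (*-monoˡ-≤ 0≤z x≤y))

  0≤1 : 0# ≤ 1#
  0≤1 with ≤-total 0# 1#
  ... | inj₁ 0≤1 = 0≤1
  ... | inj₂ 1≤0 = ≤-respʳ-≈ eq (*-nonNeg 0≤-1 0≤-1)
    where
    0≤-1 : 0# ≤ - 1#
    0≤-1 = ≤-respʳ-≈ (+-identityˡ _) (x≤y⇒0≤y-x 1≤0)
    eq : - 1# * - 1# ≈ 1#
    eq = trans (sym (-‿distribˡ-* 1# (- 1#))) (trans (-‿cong (*-identityˡ _))
      (-‿involutive 1#))

  0<1 : 0# < 1#
  0<1 = 0≤1 , 0≉1

  1≤⇒0< : ∀ {x} → 1# ≤ x → 0# < x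
  1≤⇒0< = <-≤-trans 0<1

  ⁻¹-inverseˡ : ∀ {x} → 0# < x → x ⁻¹ * x ≈ 1#
  ⁻¹-inverseˡ {x} (_ , 0≉x) = trans (*-comm _ _) (⁻¹-inverseʳ x (λ x≈0 → 0≉x (sym x≈0)))

  ⁻¹-nonNeg : ∀ {x} → 0# < x → 0# ≤ x ⁻¹
  ⁻¹-nonNeg {x} 0<x@(0≤x , _) with ≤-total 0# (x ⁻¹)
  ... | inj₁ 0≤x⁻¹ = 0≤x⁻¹
  ... | inj₂ x⁻¹≤0 = contradiction
    (≤-respˡ-≈ (⁻¹-inverseˡ 0<x) (≤-respʳ-≈ (zeroˡ x) (*-monoʳ-≤ 0≤x x⁻¹≤0))) (<⇒≱ 0<1)

  *-cancelˡ-≤ : ∀ {z x y} → 0# < z → z * x ≤ z * y → x ≤ y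
  *-cancelˡ-≤ {z} {x} {y} 0<z h =
    ≤-respˡ-≈ (eq x) (≤-respʳ-≈ (eq y) (*-monoˡ-≤ (⁻¹-nonNeg 0<z) h))
    where
    eq : ∀ w → z ⁻¹ * (z * w) ≈ w
    eq w = trans (sym (*-assoc _ _ _)) (trans (*-congʳ (⁻¹-inverseˡ 0<z)) (*-identityˡ w))

  *-/-cancel : ∀ {x} y → 0# < x → x * (y / x) ≈ y
  *-/-cancel {x} y 0<x = trans (solve 3 (λ x y z → x :* (y :* z) := y :* (z :* x)) refl x y (x ⁻¹))
    (trans (*-congˡ (⁻¹-inverseˡ 0<x)) (*-identityʳ y))

  square-cancel-≤ : ∀ {x y} → 0# ≤ x → 0# ≤ y → x * x ≤ y * y → x ≤ y
  square-cancel-≤ {x} {y} 0≤x 0≤y x²≤y² with x ≤? y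
  ... | yes x≤y = x≤y
  ... | no x≰y = *-cancelˡ-≤ 0<x (≤-trans x²≤y² (*-monoʳ-≤ 0≤y (proj₁ (≰⇒> x≰y))))
    where
    0<x : 0# < x
    0<x = ≤-<-trans 0≤y (≰⇒> x≰y)

  infixl 7 _⊓_
  _⊓_ : Carrier → Carrier → Carrier
  x ⊓ y with x ≤? y
  ... | yes _ = x
  ... | no  _ = y

  x⊓y≤x : ∀ x y → x ⊓ y ≤ x
  x⊓y≤x x y with x ≤? y
  ... | yes _   = ≤-refl
  ... | no  x≰y = ≰⇒≥ x≰y

  x⊓y≤y : ∀ x y → x ⊓ y ≤ y
  x⊓y≤y x y with x ≤? y
  ... | yes x≤y = x≤y
  ... | no  _   = ≤-refl

  ⊓-glb : ∀ {x y z} → z ≤ x → z ≤ y → z ≤ x ⊓ y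
  ⊓-glb {x} {y} z≤x z≤y with x ≤? y
  ... | yes _ = z≤x
  ... | no  _ = z≤y

  ⊓-monoˡ-≤ : ∀ z {x y} → x ≤ y → x ⊓ z ≤ y ⊓ z
  ⊓-monoˡ-≤ z {x} {y} x≤y = ⊓-glb (≤-trans (x⊓y≤x x z) x≤y) (x⊓y≤y x z)

  *-glb-⊓ : ∀ {w x y z} → z ≤ w * x → z ≤ w * y → z ≤ w * (x ⊓ y)
  *-glb-⊓ {x = x} {y} h k with x ≤? y
  ... | yes _ = h
  ... | no  _ = k

  module ×P = SemiringMult semiring

  fromℕ-nonNeg : ∀ n → 0# ≤ fromℕ n
  fromℕ-nonNeg zero    = ≤-refl
  fromℕ-nonNeg (suc n) = +-nonNeg 0≤1 (fromℕ-nonNeg n)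

  fromℕ-pos : ∀ n → 0# < fromℕ (suc n)
  fromℕ-pos n = 1≤⇒0< (x≤x+y 1# (fromℕ-nonNeg n))

  fromℕ-+ : ∀ m n → fromℕ (m ℕ.+ n) ≈ fromℕ m + fromℕ n
  fromℕ-+ = ×P.×-homo-+ 1#

  fromℕ-* : ∀ m n → fromℕ (m ℕ.* n) ≈ fromℕ m * fromℕ n
  fromℕ-* = ×P.×1-homo-*

  fromℕ-mono-≤ : ∀ {m n} → m ℕ.≤ n → fromℕ m ≤ fromℕ n
  fromℕ-mono-≤ {n = n} ℕ.z≤n = fromℕ-nonNeg n
  fromℕ-mono-≤ (ℕ.s≤s m≤n) = +-monoʳ-≤ 1# (fromℕ-mono-≤ m≤n)

-- Decimal fractions as quotients of integers.

module Decimals {c ℓ₁ ℓ₂} (ℝ : RealField c ℓ₁ ℓ₂) where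
  open RealField ℝ hiding (zero)
  open Analysis ℝ
  open OrderedField ℝ

  digits : List ℕ → ℕ
  digits []       = 0
  digits (d ∷ ds) = d ℕ.* 10 ℕ.^ length ds ℕ.+ digits ds

  scale : List ℕ → ℕ
  scale ds = 10 ℕ.^ length ds

  0·-scaled : ∀ ds → fromℕ (scale ds) * (0· ds) ≈ fromℕ (digits ds)
  0·-scaled []       = zeroʳ _
  0·-scaled (d ∷ ds) = begin
    fromℕ (10 ℕ.* K) * ((fromℕ d + 0· ds) / fromℕ 10)
      ≈⟨ *-congʳ (trans (fromℕ-* 10 K) (*-comm _ _)) ⟩
    fromℕ K * fromℕ 10 * ((fromℕ d + 0· ds) / fromℕ 10)
      ≈⟨ *-assoc _ _ _ ⟩
    fromℕ K * (fromℕ 10 * ((fromℕ d + 0· ds) / fromℕ 10))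
      ≈⟨ *-congˡ (*-/-cancel _ (fromℕ-pos 9)) ⟩
    fromℕ K * (fromℕ d + 0· ds)
      ≈⟨ distribˡ _ _ _ ⟩
    fromℕ K * fromℕ d + fromℕ K * (0· ds)
      ≈⟨ +-cong (trans (*-comm _ _) (sym (fromℕ-* d K))) (0·-scaled ds) ⟩
    fromℕ (d ℕ.* K) + fromℕ (digits ds)
      ≈⟨ fromℕ-+ (d ℕ.* K) (digits ds) ⟨
    fromℕ (d ℕ.* K ℕ.+ digits ds) ∎
    where
    open SetoidReasoning setoid
    K : ℕ
    K = scale ds

  scale-pos : ∀ ds → 0# < fromℕ (scale ds)
  scale-pos ds = go (scale ds) (ℕₚ.m^n>0 10 (length ds))
    where
    go : ∀ K → 0 ℕ.< K → 0# < fromℕ K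
    go (suc K) _ = fromℕ-pos K

  -- Multiplication by a power of ten turns the decimal into an integer, so that numerical bounds
  -- reduce to inequalities between natural numbers, which are decided by evaluation.
  scaled-≤⇒≤decimal : ∀ k ds {x} →
    fromℕ (scale ds) * x ≤ fromℕ (k ℕ.* scale ds ℕ.+ digits ds) → x ≤ decimal k ds
  scaled-≤⇒≤decimal k ds {x} h = *-cancelˡ-≤ (scale-pos ds) (≤-respʳ-≈ (sym eq) h)
    where
    eq : fromℕ (scale ds) * decimal k ds ≈ fromℕ (k ℕ.* scale ds ℕ.+ digits ds)
    eq = trans (distribˡ _ _ _)
      (trans (+-cong (trans (*-comm _ _) (sym (fromℕ-* k (scale ds)))) (0·-scaled ds))
        (sym (fromℕ-+ (k ℕ.* scale ds) (digits ds))))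

  double : ∀ x → fromℕ 2 * x ≈ x + x
  double = solve 1 (λ x → (con 1 :+ (con 1 :+ con 0)) :* x := x :+ x) refl

  double-cancel-≤ : ∀ {x y} → x + x ≤ y + y → x ≤ y
  double-cancel-≤ {x} {y} h = *-cancelˡ-≤ (fromℕ-pos 1)
    (≤-respˡ-≈ (sym (double x)) (≤-respʳ-≈ (sym (double y)) h))

  double-cancel-≈ : ∀ {x y} → x + x ≈ y + y → x ≈ y
  double-cancel-≈ h = ≤-antisym (double-cancel-≤ (≤-reflexive h))
    (double-cancel-≤ (≤-reflexive (sym h)))

  double-half : ∀ x → x / fromℕ 2 + x / fromℕ 2 ≈ x
  double-half x = trans (sym (double _)) (*-/-cancel x (fromℕ-pos 1))

-- The constants `φ` and `β`, the ratio and its limit.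

module Constants {c ℓ₁ ℓ₂} (ℝ : RealField c ℓ₁ ℓ₂) where
  open RealField ℝ hiding (zero)
  open Analysis ℝ
  open OrderedField ℝ
  open Decimals ℝ

  sqrt-scaled : ∀ K {a x} → IsSqrt a x → (fromℕ K * x) * (fromℕ K * x) ≈ fromℕ K * (fromℕ K * a)
  sqrt-scaled K {a} {x} (_ , x²≈a) =
    trans (solve 2 (λ k x → (k :* x) :* (k :* x) := k :* (k :* (x :* x))) refl (fromℕ K) x)
      (*-congˡ (*-congˡ x²≈a))

  sqrt-≤ : ∀ K A {a x} → IsSqrt a x → fromℕ K * (fromℕ K * a) ≤ fromℕ (A ℕ.* A) →
           fromℕ K * x ≤ fromℕ A
  sqrt-≤ K A hx h = square-cancel-≤ (*-nonNeg (fromℕ-nonNeg K) (proj₁ hx)) (fromℕ-nonNeg A)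
    (≤-respˡ-≈ (sym (sqrt-scaled K hx)) (≤-respʳ-≈ (fromℕ-* A A) h))

  sqrt-≥ : ∀ K A {a x} → IsSqrt a x → fromℕ (A ℕ.* A) ≤ fromℕ K * (fromℕ K * a) →
           fromℕ A ≤ fromℕ K * x
  sqrt-≥ K A hx h = square-cancel-≤ (fromℕ-nonNeg A) (*-nonNeg (fromℕ-nonNeg K) (proj₁ hx))
    (≤-respʳ-≈ (sym (sqrt-scaled K hx)) (≤-respˡ-≈ (fromℕ-* A A) h))

  fromℕ-*³ : ∀ K N → fromℕ (K ℕ.* (K ℕ.* N)) ≈ fromℕ K * (fromℕ K * fromℕ N)
  fromℕ-*³ K N = trans (fromℕ-* K _) (*-congˡ (fromℕ-* K N))

  module Golden (√5 : Carrier) (√5-sqrt : IsSqrt (fromℕ 5) √5) where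

    φ : Carrier
    φ = (1# + √5) / fromℕ 2

    2φ≈1+√5 : φ + φ ≈ 1# + √5
    2φ≈1+√5 = double-half _

    √5-≤ : ∀ K A → K ℕ.* (K ℕ.* 5) ℕ.≤ A ℕ.* A → fromℕ K * √5 ≤ fromℕ A
    √5-≤ K A h = sqrt-≤ K A √5-sqrt (≤-respˡ-≈ (fromℕ-*³ K 5) (fromℕ-mono-≤ h))

    √5-≥ : ∀ K A → A ℕ.* A ℕ.≤ K ℕ.* (K ℕ.* 5) → fromℕ A ≤ fromℕ K * √5
    √5-≥ K A h = sqrt-≥ K A √5-sqrt (≤-respʳ-≈ (fromℕ-*³ K 5) (fromℕ-mono-≤ h))

    2Kφ≈K+K√5 : ∀ K → fromℕ K * φ + fromℕ K * φ ≈ fromℕ K + fromℕ K * √5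
    2Kφ≈K+K√5 K = trans (sym (distribˡ _ _ _)) (trans (*-congˡ 2φ≈1+√5)
      (trans (distribˡ _ _ _) (+-congʳ (*-identityʳ _))))

    -- `A` is an integer upper bound for `K √5`, and `B` one for half of `K + A`. At closed numerals
    -- both hypotheses are discharged by evaluating `≤ᵇ`.
    φ-≤ : ∀ K A B → K ℕ.* (K ℕ.* 5) ℕ.≤ A ℕ.* A → K ℕ.+ A ℕ.≤ B ℕ.+ B → fromℕ K * φ ≤ fromℕ B
    φ-≤ K A B h₁ h₂ = double-cancel-≤ (≤-respˡ-≈ (sym (2Kφ≈K+K√5 K))
      (≤-trans (+-monoʳ-≤ (fromℕ K) (√5-≤ K A h₁))
        (≤-respˡ-≈ (fromℕ-+ K A) (≤-respʳ-≈ (fromℕ-+ B B) (fromℕ-mono-≤ h₂)))))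

    φ-≥ : ∀ K A B → A ℕ.* A ℕ.≤ K ℕ.* (K ℕ.* 5) → B ℕ.+ B ℕ.≤ K ℕ.+ A → fromℕ B ≤ fromℕ K * φ
    φ-≥ K A B h₁ h₂ = double-cancel-≤ (≤-respʳ-≈ (sym (2Kφ≈K+K√5 K))
      (≤-trans (≤-respˡ-≈ (fromℕ-+ B B) (≤-respʳ-≈ (fromℕ-+ K A) (fromℕ-mono-≤ h₂)))
        (+-monoʳ-≤ (fromℕ K) (√5-≥ K A h₁))))

    1≤φ : 1# ≤ φ
    1≤φ = ≤-respˡ-≈ (+-identityʳ 1#) (≤-respʳ-≈
      (trans (*-congʳ (+-identityʳ 1#)) (*-identityˡ φ))
      (φ-≥ 1 2 1 (ℕₚ.≤ᵇ⇒≤ _ _ tt) (ℕₚ.≤ᵇ⇒≤ _ _ tt)))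

    0≤φ : 0# ≤ φ
    0≤φ = ≤-trans 0≤1 1≤φ

    φ² : φ * φ ≈ φ + 1#
    φ² = double-cancel-≈ (double-cancel-≈ (begin
      φ * φ + φ * φ + (φ * φ + φ * φ)
        ≈⟨ solve 1 (λ x → x :* x :+ x :* x :+ (x :* x :+ x :* x) := (x :+ x) :* (x :+ x)) refl φ ⟩
      (φ + φ) * (φ + φ)
        ≈⟨ *-cong 2φ≈1+√5 2φ≈1+√5 ⟩
      (1# + √5) * (1# + √5)
        ≈⟨ solve 1 (λ x → (con 1 :+ x) :* (con 1 :+ x) := x :* x :+ (con 1 :+ (x :+ x))) refl √5 ⟩
      √5 * √5 + (1# + (√5 + √5))
        ≈⟨ +-congʳ (proj₂ √5-sqrt) ⟩
      fromℕ 5 + (1# + (√5 + √5))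
        ≈⟨ solve 1 (λ x → (con 1 :+ (con 1 :+ (con 1 :+ (con 1 :+ (con 1 :+ con 0))))) :+ (con 1 :+ (x :+ x))
                      := con 4 :+ ((con 1 :+ x) :+ (con 1 :+ x))) refl √5 ⟩
      four + ((1# + √5) + (1# + √5))
        ≈⟨ +-congˡ (+-cong 2φ≈1+√5 2φ≈1+√5) ⟨
      four + ((φ + φ) + (φ + φ))
        ≈⟨ solve 1 (λ x → con 4 :+ ((x :+ x) :+ (x :+ x))
                      := x :+ con 1 :+ (x :+ con 1) :+ (x :+ con 1 :+ (x :+ con 1))) refl φ ⟩
      φ + 1# + (φ + 1#) + (φ + 1# + (φ + 1#)) ∎))
      where
      open SetoidReasoning setoid
      four : Carrier
      four = 1# + 1# + 1# + 1#

    module Ratio (r : Carrier) (r-sqrt : IsSqrt (fromℕ 5 * φ + 1#) r) where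

      β : Carrier
      β = (φ + r) / fromℕ 2

      2β≈φ+r : β + β ≈ φ + r
      2β≈φ+r = double-half _

      -- `β` is the positive root of `x² = φ x + φ`: the discriminant `φ² + 4φ` equals `5φ + 1`
      -- because `φ² = φ + 1`. The equation is proved multiplied by four, which removes the halves.
      β² : β * β ≈ φ * β + φ
      β² = double-cancel-≈ (double-cancel-≈ (begin
        β * β + β * β + (β * β + β * β)
          ≈⟨ solve 1 (λ x → x :* x :+ x :* x :+ (x :* x :+ x :* x) := (x :+ x) :* (x :+ x)) refl β ⟩
        (β + β) * (β + β)
          ≈⟨ *-cong 2β≈φ+r 2β≈φ+r ⟩
        (φ + r) * (φ + r)
          ≈⟨ solve 2 (λ x r → (x :+ r) :* (x :+ r) := x :* x :+ x :* r :+ x :* r :+ r :* r) refl φ r ⟩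
        φ * φ + φ * r + φ * r + r * r
          ≈⟨ +-congˡ (proj₂ r-sqrt) ⟩
        φ * φ + φ * r + φ * r + (fromℕ 5 * φ + 1#)
          ≈⟨ solve 2 (λ x r → x :* x :+ x :* r :+ x :* r :+ ((con 1 :+ (con 1 :+ (con 1 :+ (con 1 :+ (con 1 :+ con 0))))) :* x :+ con 1)
                   := (x :+ con 1) :+ (x :* x :+ x :* r :+ x :* r :+ con 4 :* x)) refl φ r ⟩
        (φ + 1#) + (φ * φ + φ * r + φ * r + four * φ)
          ≈⟨ +-congʳ φ² ⟨
        φ * φ + (φ * φ + φ * r + φ * r + four * φ)
          ≈⟨ solve 2 (λ x r → x :* x :+ (x :* x :+ x :* r :+ x :* r :+ con 4 :* x)
                   := x :* (x :+ r) :+ x :* (x :+ r) :+ con 4 :* x) refl φ r ⟩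
        φ * (φ + r) + φ * (φ + r) + four * φ
          ≈⟨ +-congʳ (+-cong (*-congˡ 2β≈φ+r) (*-congˡ 2β≈φ+r)) ⟨
        φ * (β + β) + φ * (β + β) + four * φ
          ≈⟨ solve 2 (λ x b → x :* (b :+ b) :+ x :* (b :+ b) :+ con 4 :* x
                   := x :* b :+ x :+ (x :* b :+ x) :+ (x :* b :+ x :+ (x :* b :+ x))) refl φ β ⟩
        φ * β + φ + (φ * β + φ) + (φ * β + φ + (φ * β + φ)) ∎))
        where
        open SetoidReasoning setoid
        four : Carrier
        four = 1# + 1# + 1# + 1#

      -- After squaring, `(3φ)² = 9φ + 9` exceeds `5φ + 1` by `4φ + 8`. The purpose is `β ≤ 2φ`.
      r≤3φ : r ≤ φ + φ + φ
      r≤3φ = square-cancel-≤ (proj₁ r-sqrt) (+-nonNeg (+-nonNeg 0≤φ 0≤φ) 0≤φ)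
        (≤-respˡ-≈ (sym (proj₂ r-sqrt)) (≤-respʳ-≈ (sym eq)
          (x≤x+y _ (+-nonNeg (*-nonNeg (fromℕ-nonNeg 4) 0≤φ) (fromℕ-nonNeg 8)))))
        where
        eq : (φ + φ + φ) * (φ + φ + φ) ≈ (fromℕ 5 * φ + 1#) + (fromℕ 4 * φ + fromℕ 8)
        eq = trans (solve 1 (λ x → (x :+ x :+ x) :* (x :+ x :+ x) := con 9 :* (x :* x)) refl φ)
          (trans (*-congˡ φ²)
            (solve 1 (λ x → con 9 :* (x :+ con 1)
               := ((con 1 :+ (con 1 :+ (con 1 :+ (con 1 :+ (con 1 :+ con 0))))) :* x :+ con 1)
               :+ ((con 1 :+ (con 1 :+ (con 1 :+ (con 1 :+ con 0)))) :* x
               :+ (con 1 :+ (con 1 :+ (con 1 :+ (con 1 :+ (con 1 :+ (con 1 :+ (con 1 :+ (con 1 :+ con 0)))))))))) refl φ))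

      β≤2φ : β ≤ φ + φ
      β≤2φ = double-cancel-≤ (≤-respˡ-≈ (sym 2β≈φ+r) (≤-respʳ-≈
        (solve 1 (λ x → x :+ (x :+ x :+ x) := x :+ x :+ (x :+ x)) refl φ) (+-monoʳ-≤ φ r≤3φ)))

      1≤β : 1# ≤ β
      1≤β = double-cancel-≤ (≤-respʳ-≈ (sym 2β≈φ+r) (+-mono-≤ 1≤φ 1≤r))
        where
        1≤r : 1# ≤ r
        1≤r = square-cancel-≤ 0≤1 (proj₁ r-sqrt) (≤-respʳ-≈ (sym (proj₂ r-sqrt))
          (≤-respˡ-≈ (sym (*-identityˡ 1#)) (x≤y+x 1# (*-nonNeg (fromℕ-nonNeg 5) 0≤φ))))

      0<β : 0# < β
      0<β = 1≤⇒0< 1≤β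

      0≤β : 0# ≤ β
      0≤β = proj₁ 0<β

      φ≤β : φ ≤ β
      φ≤β = *-cancelˡ-≤ 0<β (≤-respʳ-≈ (sym β²)
        (≤-respˡ-≈ (*-comm φ β) (x≤x+y _ 0≤φ)))

      3≤r : fromℕ 3 ≤ r
      3≤r = square-cancel-≤ (fromℕ-nonNeg 3) (proj₁ r-sqrt) (≤-respʳ-≈ (sym (proj₂ r-sqrt))
        (≤-respˡ-≈ (trans (+-comm _ _) (fromℕ-* 3 3))
          -- `11/5 ≤ √5` gives `8 ≤ 5φ`, hence `9 ≤ 5φ + 1`.
          (+-monoˡ-≤ 1# (φ-≥ 5 11 8 (ℕₚ.≤ᵇ⇒≤ _ _ tt) (ℕₚ.≤ᵇ⇒≤ _ _ tt)))))

      -- Doubled and with `2β = φ + r`, the claim reads `3φ ≤ r + 2`; it follows from `3φ ≤ 5` and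
      -- `3 ≤ r`.
      2φ≤β+1 : φ + φ ≤ β + 1#
      2φ≤β+1 = double-cancel-≤ (begin
        φ + φ + (φ + φ)
          ≈⟨ solve 1 (λ x → x :+ x :+ (x :+ x) :=
               x :+ (con 1 :+ (con 1 :+ (con 1 :+ con 0))) :* x) refl φ ⟩
        φ + fromℕ 3 * φ
          ≤⟨ +-monoʳ-≤ φ (φ-≤ 3 7 5 (ℕₚ.≤ᵇ⇒≤ _ _ tt) (ℕₚ.≤ᵇ⇒≤ _ _ tt)) ⟩
        φ + fromℕ 5
          ≈⟨ +-congˡ (fromℕ-+ 3 2) ⟩
        φ + (fromℕ 3 + fromℕ 2)
          ≤⟨ +-monoʳ-≤ φ (+-monoˡ-≤ (fromℕ 2) 3≤r) ⟩
        φ + (r + fromℕ 2)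
          ≈⟨ +-assoc _ _ _ ⟨
        φ + r + fromℕ 2
          ≈⟨ +-congʳ 2β≈φ+r ⟨
        β + β + fromℕ 2
          ≈⟨ solve 1 (λ b → b :+ b :+ (con 1 :+ (con 1 :+ con 0)) := b :+ con 1 :+ (b :+ con 1)) refl β ⟩
        β + 1# + (β + 1#) ∎)
        where open ≤R

      2≤β : fromℕ 2 ≤ β
      2≤β = +-cancelʳ-≤ 1# (≤-trans
        (≤-respˡ-≈ (+-comm 1# (fromℕ 2)) (≤-respʳ-≈ (double φ)
          (φ-≥ 2 4 3 (ℕₚ.≤ᵇ⇒≤ _ _ tt) (ℕₚ.≤ᵇ⇒≤ _ _ tt)))) 2φ≤β+1)

      r-≤ : ∀ K B R → fromℕ K * φ ≤ fromℕ B → K ℕ.* (5 ℕ.* B ℕ.+ K) ℕ.≤ R ℕ.* R →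
            fromℕ K * r ≤ fromℕ R
      r-≤ K B R h₁ h₂ = sqrt-≤ K R r-sqrt (begin
        fromℕ K * (fromℕ K * (fromℕ 5 * φ + 1#))
          ≈⟨ solve 3 (λ k f p → k :* (k :* (f :* p :+ con 1)) := k :* (f :* (k :* p) :+ k)) refl
               (fromℕ K) (fromℕ 5) φ ⟩
        fromℕ K * (fromℕ 5 * (fromℕ K * φ) + fromℕ K)
          ≤⟨ *-monoˡ-≤ (fromℕ-nonNeg K) (+-monoˡ-≤ (fromℕ K) (*-monoˡ-≤ (fromℕ-nonNeg 5) h₁)) ⟩
        fromℕ K * (fromℕ 5 * fromℕ B + fromℕ K)
          ≈⟨ *-congˡ (trans (fromℕ-+ (5 ℕ.* B) K) (+-congʳ (fromℕ-* 5 B))) ⟨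
        fromℕ K * fromℕ (5 ℕ.* B ℕ.+ K)
          ≈⟨ fromℕ-* K _ ⟨
        fromℕ (K ℕ.* (5 ℕ.* B ℕ.+ K))
          ≤⟨ fromℕ-mono-≤ h₂ ⟩
        fromℕ (R ℕ.* R) ∎)
        where open ≤R

      β-≤ : ∀ K B R V → fromℕ K * φ ≤ fromℕ B → fromℕ K * r ≤ fromℕ R →
            B ℕ.+ R ℕ.≤ V ℕ.+ V → fromℕ K * β ≤ fromℕ V
      β-≤ K B R V h₁ h₂ h₃ = double-cancel-≤ (begin
        fromℕ K * β + fromℕ K * β ≈⟨ distribˡ _ _ _ ⟨
        fromℕ K * (β + β)         ≈⟨ *-congˡ 2β≈φ+r ⟩
        fromℕ K * (φ + r)         ≈⟨ distribˡ _ _ _ ⟩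
        fromℕ K * φ + fromℕ K * r ≤⟨ +-mono-≤ h₁ h₂ ⟩
        fromℕ B + fromℕ R         ≈⟨ fromℕ-+ B R ⟨
        fromℕ (B ℕ.+ R)           ≤⟨ fromℕ-mono-≤ h₃ ⟩
        fromℕ (V ℕ.+ V)           ≈⟨ fromℕ-+ V V ⟩
        fromℕ V + fromℕ V         ∎)
        where open ≤R

      scaled-φ-≤ : fromℕ 100000 * φ ≤ fromℕ 161804
      scaled-φ-≤ = φ-≤ 100000 223608 161804 (ℕₚ.≤ᵇ⇒≤ _ _ tt) (ℕₚ.≤ᵇ⇒≤ _ _ tt)

      scaled-β-≤ : fromℕ 100000 * β ≤ fromℕ 231652
      -- The numerals are upper bounds multiplied by `10⁵`: `1.61804` for `φ`, `3.01500` for `r`,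
      -- and their mean `2.31652` for `β`.
      scaled-β-≤ = β-≤ 100000 161804 301500 231652 scaled-φ-≤
        (r-≤ 100000 161804 301500 scaled-φ-≤ (ℕₚ.≤ᵇ⇒≤ _ _ tt)) (ℕₚ.≤ᵇ⇒≤ _ _ tt)

      β≤2·31652 : β ≤ decimal 2 (3 ∷ 1 ∷ 6 ∷ 5 ∷ 2 ∷ [])
      β≤2·31652 = scaled-≤⇒≤decimal 2 (3 ∷ 1 ∷ 6 ∷ 5 ∷ 2 ∷ []) scaled-β-≤

      limit : Carrier
      limit = β / fromℕ 2 + φ

      limit≤2·77630 : limit ≤ decimal 2 (7 ∷ 7 ∷ 6 ∷ 3 ∷ 0 ∷ [])
      limit≤2·77630 = scaled-≤⇒≤decimal 2 (7 ∷ 7 ∷ 6 ∷ 3 ∷ 0 ∷ []) (go 100000 231652 161804 277630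
        scaled-β-≤ scaled-φ-≤ (ℕₚ.≤ᵇ⇒≤ _ _ tt))
        where
        open ≤R
        go : ∀ K V B U → fromℕ K * β ≤ fromℕ V → fromℕ K * φ ≤ fromℕ B →
             V ℕ.+ (B ℕ.+ B) ℕ.≤ U ℕ.+ U → fromℕ K * limit ≤ fromℕ U
        go K V B U h₁ h₂ h₃ = double-cancel-≤ (begin
          fromℕ K * limit + fromℕ K * limit
            ≈⟨ solve 3 (λ k b p → k :* (b :+ p) :+ k :* (b :+ p) :=
                 k :* (b :+ b) :+ (k :* p :+ k :* p)) refl (fromℕ K) (β / fromℕ 2) φ ⟩
          fromℕ K * (β / fromℕ 2 + β / fromℕ 2) + (fromℕ K * φ + fromℕ K * φ)
            ≈⟨ +-congʳ (*-congˡ (double-half β)) ⟩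
          fromℕ K * β + (fromℕ K * φ + fromℕ K * φ)
            ≤⟨ +-mono-≤ h₁ (+-mono-≤ h₂ h₂) ⟩
          fromℕ V + (fromℕ B + fromℕ B)
            ≈⟨ trans (fromℕ-+ V _) (+-congˡ (fromℕ-+ B B)) ⟨
          fromℕ (V ℕ.+ (B ℕ.+ B))
            ≤⟨ fromℕ-mono-≤ h₃ ⟩
          fromℕ (U ℕ.+ U)
            ≈⟨ fromℕ-+ U U ⟩
          fromℕ U + fromℕ U ∎)

      bound : ℕ → Carrier
      bound m = β * (1# / fromℕ 2 + 1# / (fromℕ 2 * fromℕ m)) + φ * (1# - 1# / fromℕ m)

      -- Multiplication by `2m` clears all denominators; `competitive` compares the costs in this
      -- form.
      2M*bound : ∀ k → (fromℕ (suc k) + fromℕ (suc k)) * bound (suc k) ≈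
                 β * (fromℕ (suc k) + 1#) + (φ + φ) * fromℕ k
      2M*bound k = begin
        (M + M) * (β * (1# / two + 1# / (two * M)) + φ * (1# - 1# / M))
          ≈⟨ solve 6 (λ m b h q p d → (m :+ m) :* (b :* (h :+ q) :+ p :* d) :=
               b :* (m :* (h :+ h) :+ (m :+ m) :* q) :+ (p :+ p) :* (m :* d)) refl
               M β (1# / two) (1# / (two * M)) φ (1# - 1# / M) ⟩
        β * (M * (1# / two + 1# / two) + (M + M) * (1# / (two * M))) + (φ + φ) * (M * (1# - 1# / M))
          ≈⟨ +-cong (*-congˡ (+-cong (trans (*-congˡ (double-half 1#)) (*-identityʳ M))
               (trans (*-congʳ (sym (double M))) (*-/-cancel 1# 0<2M)))) (*-congˡ M[1-1/M]≈k) ⟩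
        β * (M + 1#) + (φ + φ) * fromℕ k ∎
        where
        open SetoidReasoning setoid
        M two : Carrier
        M = fromℕ (suc k)
        two = fromℕ 2
        0<2M : 0# < two * M
        0<2M = <-≤-trans (fromℕ-pos k) (≤-respʳ-≈ (sym (double M)) (x≤x+y M (fromℕ-nonNeg (suc k))))
        M[1-1/M]≈k : M * (1# - 1# / M) ≈ fromℕ k
        M[1-1/M]≈k = +-cancelʳ-≈ 1# (trans (+-congˡ (sym (*-/-cancel 1# (fromℕ-pos k))))
          (trans (sym (distribˡ _ _ _)) (trans (*-congˡ (x-y+y≈x _ _))
            (trans (*-identityʳ M) (+-comm _ _)))))

      -- This is `2m (limit - bound m) = 2φ - β`, written without subtraction. As `β ≤ 2φ`, the
      -- limit is approached from below.
      bound-limit : ∀ k → let M = fromℕ (suc k) in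
                    (M + M) * bound (suc k) + (φ + φ) ≈ (M + M) * limit + β
      bound-limit k = begin
        (M + M) * bound (suc k) + (φ + φ)
          ≈⟨ +-congʳ (2M*bound k) ⟩
        β * (M + 1#) + (φ + φ) * fromℕ k + (φ + φ)
          ≈⟨ solve 3 (λ b p k → b :* (con 1 :+ k :+ con 1) :+ (p :+ p) :* k :+ (p :+ p) :=
               (con 1 :+ k) :* b :+ (con 1 :+ k :+ (con 1 :+ k)) :* p :+ b) refl β φ (fromℕ k) ⟩
        M * β + (M + M) * φ + β
          ≈⟨ +-congʳ (+-congʳ (*-congˡ (double-half β))) ⟨
        M * (β / fromℕ 2 + β / fromℕ 2) + (M + M) * φ + β
          ≈⟨ solve 4 (λ m h p b → m :* (h :+ h) :+ (m :+ m) :* p :+ b :=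
               (m :+ m) :* (h :+ p) :+ b) refl M (β / fromℕ 2) φ β ⟩
        (M + M) * limit + β ∎
        where
        open SetoidReasoning setoid
        M : Carrier
        M = fromℕ (suc k)

      bound-tendsTo : TendsTo bound limit
      bound-tendsTo δ 0<δ with archimedean (φ / δ)
      -- For `m > N` one has `φ ≤ m δ`, and the gap `(2φ - β) / 2m` is below `δ` because `0 < β`.
      -- Starting at `suc N` also makes `m` a successor, as `bound-limit` requires.
      ... | N , φ/δ≤N = suc N , close
        where
        close : ∀ m → suc N ℕ.≤ m → limit - δ < bound m × bound m < limit + δ
        close (suc k) (ℕ.s≤s N≤k) = ≰⇒> lower , upper
          where
          M : Carrier
          M = fromℕ (suc k)
          0<2M : 0# < M + M
          0<2M = <-≤-trans (fromℕ-pos k) (x≤x+y M (fromℕ-nonNeg (suc k)))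
          φ≤Mδ : φ ≤ M * δ
          φ≤Mδ = begin
            φ           ≈⟨ *-/-cancel φ 0<δ ⟨
            δ * (φ / δ) ≤⟨ *-monoˡ-≤ (proj₁ 0<δ) (≤-trans φ/δ≤N (fromℕ-mono-≤ (ℕₚ.≤-trans N≤k (ℕₚ.n≤1+n k)))) ⟩
            δ * M       ≈⟨ *-comm δ M ⟩
            M * δ       ∎
            where open ≤R
          lower : ¬ bound (suc k) ≤ limit - δ
          lower h = <⇒≱ 0<β (linear _ _ (+-mono-≤ (+-mono-≤ scaled φ≤Mδ) φ≤Mδ)
            (trans (solve 4 (λ b l m e → b :+ ((m :+ m) :* l :+ m :* e :+ m :* e) :=
                       (m :+ m) :* l :+ b :+ (m :+ m) :* e) refl β limit M δ)
              (trans (+-congʳ (sym (bound-limit k)))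
                (solve 4 (λ f p m e → (m :+ m) :* f :+ (p :+ p) :+ (m :+ m) :* e :=
                       con 0 :+ ((m :+ m) :* (f :+ e) :+ p :+ p)) refl (bound (suc k)) φ M δ))))
            where
            scaled : (M + M) * (bound (suc k) + δ) ≤ (M + M) * limit
            scaled = *-monoˡ-≤ (proj₁ 0<2M) (≤-respʳ-≈ (x-y+y≈x limit δ) (+-monoˡ-≤ δ h))
          upper : bound (suc k) < limit + δ
          upper = ≤-<-trans (*-cancelˡ-≤ 0<2M (linear _ _ β≤2φ (bound-limit k)))
            (x≤x+y limit (proj₁ 0<δ) , λ eq → proj₂ 0<δ
              (+-cancelʳ-≈ limit (trans (+-identityˡ limit) (trans eq (+-comm limit δ)))))

AllPairs-map-with : ∀ {a p r s} {A : Set a} {P : Pred A p} {R : Rel A r} {S : Rel A s} {xs} →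
  (∀ {x y} → P x → P y → R x y → S x y) → All P xs → AllPairs R xs → AllPairs S xs
AllPairs-map-with f []         []         = []
AllPairs-map-with f (px ∷ pxs) (rx ∷ rxs) =
  All.zipWith (λ (py , r) → f px py r) (pxs , rx) ∷ AllPairs-map-with f pxs rxs

-- Finite sums over `Fin n` and over lists.

module Sums {c ℓ₁ ℓ₂} (ℝ : RealField c ℓ₁ ℓ₂) where
  open RealField ℝ hiding (zero)
  open OrderedField ℝ
  open SemiringSum semiring public
    using (sum-cong-≋; ∑-distrib-+; ∑-comm; *-distribˡ-sum; sum-replicate-zero)

  sum-mono-≤ : ∀ {n} {f g : Fin n → Carrier} → (∀ i → f i ≤ g i) → sum f ≤ sum g
  sum-mono-≤ {zero}  f≤g = ≤-refl
  sum-mono-≤ {suc n} f≤g = +-mono-≤ (f≤g zero) (sum-mono-≤ (f≤g ∘ suc))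

  sum-const : ∀ n x → sum {n} (λ _ → x) ≈ fromℕ n * x
  sum-const zero    x = sym (zeroˡ x)
  sum-const (suc n) x = trans (+-cong (sym (*-identityˡ x)) (sum-const n x)) (sym (distribʳ x 1# _))

  at : ∀ {n} → Fin n → Carrier → Fin n → Carrier
  at i x j = if does (i Finₚ.≟ j) then x else 0#

  sum-at : ∀ {n} (i : Fin n) x → sum (at i x) ≈ x
  sum-at {suc n} zero    x = trans (+-congˡ (sum-replicate-zero n)) (+-identityʳ x)
  sum-at {suc n} (suc i) x = trans (+-identityˡ _) (sum-at i x)

  at-self : ∀ {n} (i : Fin n) x → at i x i ≈ x
  at-self i x with i Finₚ.≟ i
  ... | yes _   = refl
  ... | no  i≢i = contradiction ≡.refl i≢i

  at-other : ∀ {n} {i j : Fin n} x → i ≢ j → at i x j ≈ 0#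
  at-other {i = i} {j} x i≢j with i Finₚ.≟ j
  ... | yes i≡j = contradiction i≡j i≢j
  ... | no  _   = refl

  module _ {a} {A : Set a} where

    ∑ : List A → (A → Carrier) → Carrier
    ∑ []      f = 0#
    ∑ (x ∷ l) f = f x + ∑ l f

    ∑-cong : ∀ l {f g : A → Carrier} → (∀ x → f x ≈ g x) → ∑ l f ≈ ∑ l g
    ∑-cong []      f≈g = refl
    ∑-cong (x ∷ l) f≈g = +-cong (f≈g x) (∑-cong l f≈g)

    ∑-mono-≤ : ∀ l {f g : A → Carrier} → (∀ x → f x ≤ g x) → ∑ l f ≤ ∑ l g
    ∑-mono-≤ []      f≤g = ≤-refl
    ∑-mono-≤ (x ∷ l) f≤g = +-mono-≤ (f≤g x) (∑-mono-≤ l f≤g)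

    ∑-+ : ∀ l (f g : A → Carrier) → ∑ l (λ x → f x + g x) ≈ ∑ l f + ∑ l g
    ∑-+ []      f g = sym (+-identityˡ 0#)
    ∑-+ (x ∷ l) f g = trans (+-congˡ (∑-+ l f g))
      (solve 4 (λ a b c d → a :+ b :+ (c :+ d) := a :+ c :+ (b :+ d)) refl (f x) (g x) (∑ l f) (∑ l g))

    ∑-++ : ∀ l l′ (f : A → Carrier) → ∑ (l ++ l′) f ≈ ∑ l f + ∑ l′ f
    ∑-++ []      l′ f = sym (+-identityˡ _)
    ∑-++ (x ∷ l) l′ f = trans (+-congˡ (∑-++ l l′ f)) (sym (+-assoc _ _ _))

    ∑-↭ : ∀ {l l′} (f : A → Carrier) → l ↭ l′ → ∑ l f ≈ ∑ l′ f
    ∑-↭ f ↭.refl          = refl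
    ∑-↭ f (↭.prep x p)    = +-congˡ (∑-↭ f p)
    ∑-↭ f (↭.swap x y p)  = trans (+-congˡ (+-congˡ (∑-↭ f p)))
      (solve 3 (λ a b c → a :+ (b :+ c) := b :+ (a :+ c)) refl (f x) (f y) _)
    ∑-↭ f (↭.trans p₁ p₂) = trans (∑-↭ f p₁) (∑-↭ f p₂)

    ∑-sum-comm : ∀ {n} l (f : A → Fin n → Carrier) →
      ∑ l (λ x → sum (f x)) ≈ sum (λ k → ∑ l (λ x → f x k))
    ∑-sum-comm {n} []  f = sym (sum-replicate-zero n)
    ∑-sum-comm (x ∷ l) f = trans (+-congˡ (∑-sum-comm l f)) (sym (∑-distrib-+ (f x) _))

    -- Double counting: `at` spreads each term over all indices, and it lands only at `g x`. This
    -- splits work by machines and, later, by jobs.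
    ∑-group : ∀ {n} l (g : A → Fin n) (f : A → Carrier) →
      ∑ l f ≈ sum (λ k → ∑ l (λ x → at (g x) (f x) k))
    ∑-group l g f = trans (∑-cong l (λ x → sym (sum-at (g x) (f x))))
      (∑-sum-comm l (λ x → at (g x) (f x)))

  ∑-concatMap : ∀ {a b} {A : Set a} {B : Set b} (h : A → List B) l f →
    ∑ (concatMap h l) f ≈ ∑ l (λ x → ∑ (h x) f)
  ∑-concatMap h []      f = refl
  ∑-concatMap h (x ∷ l) f = trans (∑-++ (h x) _ f) (+-congˡ (∑-concatMap h l f))

  ∑-tabulate : ∀ {a} {A : Set a} {n} (g : Fin n → A) f → ∑ (tabulate g) f ≈ sum (f ∘ g)
  ∑-tabulate {n = zero}  g f = refl
  ∑-tabulate {n = suc n} g f = +-congˡ (∑-tabulate (g ∘ suc) f)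

  ∑-allFin : ∀ {n} (f : Fin n → Carrier) → ∑ (allFin n) f ≈ sum f
  ∑-allFin = ∑-tabulate id

-- Disjoint intervals inside a given interval.

module Packing {c ℓ₁ ℓ₂} (ℝ : RealField c ℓ₁ ℓ₂) where
  open RealField ℝ hiding (zero)
  open OrderedField ℝ
  open Sums ℝ

  module _ {a} {A : Set a} where

    Within : (lo hi : Carrier) (s d : A → Carrier) → Pred A ℓ₂
    Within lo hi s d x = lo ≤ s x × s x + d x ≤ hi

    Disjoint : (s d : A → Carrier) → Rel A ℓ₂
    Disjoint s d x y = s x + d x ≤ s y ⊎ s y + d y ≤ s x

    -- `end` and `w` are the end and the length of the interval that is cut out; whatever lies to
    -- its right moves left by `w`.
    shift : Carrier → Carrier → (A → Carrier) → A → Carrier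
    shift end w s y with end ≤? s y
    ... | yes _ = s y - w
    ... | no  _ = s y

    -- Cutting out the interval of the first element and closing the gap leaves
    -- a disjoint family; this avoids sorting the intervals.
    packing : ∀ l (s d : A → Carrier) {lo hi} → lo ≤ hi → (∀ x → 0# ≤ d x) →
      All (Within lo hi s d) l → AllPairs (Disjoint s d) l → lo + ∑ l d ≤ hi
    packing []      s d lo≤hi 0≤d []        []       = ≤-respˡ-≈ (sym (+-identityʳ _)) lo≤hi
    packing (x ∷ l) s d {lo} {hi} lo≤hi 0≤d ((lo≤sx , ex≤hi) ∷ ws) (ds ∷ dss) =
      ≤-respˡ-≈ (solve 3 (λ l d e → l :+ e :+ d := l :+ (d :+ e)) refl lo (d x) (∑ l d))
        (≤-respʳ-≈ (x-y+y≈x hi (d x)) (+-monoˡ-≤ (d x)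
          (packing l s′ d lo≤hi′ 0≤d
            (All.zipWith (λ {y} (w , r) → within {y} w r) (ws , ds))
            (AllPairs-map-with (λ {y} {z} → disjoint {y} {z}) ds dss))))
      where
      s′ : A → Carrier
      s′ = shift (s x + d x) (d x) s
      ≤-minus : ∀ {y z} → y + d x ≤ z → y ≤ z - d x
      ≤-minus h = ≤-respˡ-≈ (x+y-y≈x _ (d x)) (+-monoˡ-≤ (- d x) h)
      -+-comm : ∀ y z w → y - w + z ≈ y + z - w
      -+-comm y z w = solve 3 (λ y z d → y :+ z :+ d := y :+ d :+ z) refl y (- w) z
      lo≤hi′ : lo ≤ hi - d x
      lo≤hi′ = ≤-minus (≤-trans (+-monoˡ-≤ (d x) lo≤sx) ex≤hi)
      sx≤hi′ : s x ≤ hi - d x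
      sx≤hi′ = ≤-minus ex≤hi
      left : ∀ {y} → ¬ s x + d x ≤ s y → Disjoint s d x y → s y + d y ≤ s x
      left ¬r (inj₁ r) = contradiction r ¬r
      left ¬r (inj₂ l) = l
      within : ∀ {y} → Within lo hi s d y → Disjoint s d x y → Within lo (hi - d x) s′ d y
      within {y} (lo≤sy , ey≤hi) r with s x + d x ≤? s y
      ... | yes ex≤sy = ≤-trans lo≤sx (≤-minus ex≤sy) ,
        ≤-respˡ-≈ (sym (-+-comm (s y) (d y) (d x))) (+-monoˡ-≤ (- d x) ey≤hi)
      ... | no ex≰sy = lo≤sy , ≤-trans (left ex≰sy r) sx≤hi′
      disjoint : ∀ {y z} → Disjoint s d x y → Disjoint s d x z →
                 Disjoint s d y z → Disjoint s′ d y z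
      disjoint {y} {z} ry rz r with s x + d x ≤? s y | s x + d x ≤? s z
      ... | yes ex≤sy | yes ex≤sz = [ inj₁ ∘ go , inj₂ ∘ go ]′ r
        where
        go : ∀ {u v w} → u + v ≤ w → u - d x + v ≤ w - d x
        go h = ≤-respˡ-≈ (sym (-+-comm _ _ _)) (+-monoˡ-≤ (- d x) h)
      ... | yes ex≤sy | no ex≰sz = inj₂ (≤-trans (left ex≰sz rz) (≤-minus ex≤sy))
      ... | no ex≰sy | yes ex≤sz = inj₁ (≤-trans (left ex≰sy ry) (≤-minus ex≤sz))
      ... | no ex≰sy | no ex≰sz = r

-- Start times, completion times and job sizes.

module Slots {c ℓ₁ ℓ₂} (ℝ : RealField c ℓ₁ ℓ₂) where
  open RealField ℝ hiding (zero)
  open Scheduling ℝ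
  open OrderedField ℝ

  job : ∀ {n} → Task n → Fin n
  job (untested j) = j
  job (test j)     = j
  job (exec j)     = j

  firstSlot lastSlot : ∀ {m} → Plan m → Slot m
  firstSlot (runUntested s)   = s
  firstSlot (testThenRun s _) = s
  lastSlot (runUntested s)   = s
  lastSlot (testThenRun _ s) = s

  -- Meaningful only if the task is scheduled by σ.
  slotOf : ∀ {n m} → Schedule n m → Task n → Slot m
  slotOf σ (untested j) = lastSlot (σ j)
  slotOf σ (test j)     = firstSlot (σ j)
  slotOf σ (exec j)     = lastSlot (σ j)

  slotOf-scheduled : ∀ {n m} {σ : Schedule n m} {y s} → Scheduled σ y s → slotOf σ y ≡ s
  slotOf-scheduled (untested eq) = ≡.cong lastSlot eq
  slotOf-scheduled (test eq)     = ≡.cong firstSlot eq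
  slotOf-scheduled (exec eq)     = ≡.cong lastSlot eq

  startOf : ∀ {n m} → Schedule n m → Task n → Carrier
  startOf σ y = start (slotOf σ y)

  completion-untested : ∀ {n m} (I : Instance n) (σ : Schedule n m) {j a} →
    σ j ≡ runUntested a → completion I σ j ≡ startOf σ (untested j) + Instance.u I j
  completion-untested I σ eq rewrite eq = ≡.refl

  completion-tested : ∀ {n m} (I : Instance n) (σ : Schedule n m) {j a b} →
    σ j ≡ testThenRun a b → completion I σ j ≡ startOf σ (exec j) + Instance.p I j
  completion-tested I σ eq rewrite eq = ≡.refl

  size : ∀ {n} → Instance n → Fin n → Carrier
  size I j = Instance.u I j ⊓ (Instance.t I j + Instance.p I j)

  size-nonNeg : ∀ {n} (I : Instance n) j → 0# ≤ size I j
  size-nonNeg I j = ⊓-glb (0≤u j) (+-nonNeg (0≤t j) (0≤p j))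
    where open Instance I

  0≤duration : ∀ {n} (I : Instance n) y → 0# ≤ duration I y
  0≤duration I (untested j) = Instance.0≤u I j
  0≤duration I (test j)     = Instance.0≤t I j
  0≤duration I (exec j)     = Instance.0≤p I j

-- Truncation at a threshold.

module Truncation {c ℓ₁ ℓ₂} (ℝ : RealField c ℓ₁ ℓ₂) where
  open RealField ℝ hiding (zero)
  open OrderedField ℝ

  -- The positive part of `x - θ`. Defined through `⊓`, it complements the truncation `x ⊓ θ`
  -- without any case distinction.
  excess : Carrier → Carrier → Carrier
  excess θ x = x - x ⊓ θ

  ⊓+excess : ∀ θ x → x ⊓ θ + excess θ x ≈ x
  ⊓+excess θ x = trans (+-comm _ _) (x-y+y≈x x (x ⊓ θ))

  excess-nonNeg : ∀ θ x → 0# ≤ excess θ x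
  excess-nonNeg θ x = x≤y⇒0≤y-x (x⊓y≤x x θ)

  excess-≤-mono : ∀ θ {x y} → x ≤ y → excess θ x ≤ excess θ y
  excess-≤-mono θ {x} {y} x≤y = linear _ _ x+y⊓θ≤y+x⊓θ (begin
    excess θ x + (y + x ⊓ θ)
      ≈⟨ solve 3 (λ a b c → a :+ (b :+ c) := c :+ a :+ b) refl _ _ _ ⟩
    x ⊓ θ + excess θ x + y
      ≈⟨ +-cong (⊓+excess θ x) (sym (⊓+excess θ y)) ⟩
    x + (y ⊓ θ + excess θ y)
      ≈⟨ solve 3 (λ a b c → a :+ (b :+ c) := c :+ (a :+ b)) refl _ _ _ ⟩
    excess θ y + (x + y ⊓ θ) ∎)
    where
    open SetoidReasoning setoid
    x+y⊓θ≤y+x⊓θ : x + y ⊓ θ ≤ y + x ⊓ θ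
    x+y⊓θ≤y+x⊓θ with x ≤? θ
    ... | yes _ = ≤-respʳ-≈ (+-comm x y) (+-monoʳ-≤ x (x⊓y≤x y θ))
    ... | no  _ = +-mono-≤ x≤y (x⊓y≤y y θ)

  excess-zero : ∀ {θ x} → x ≤ θ → excess θ x ≤ 0#
  excess-zero {θ} {x} x≤θ with x ≤? θ
  ... | yes _   = ≤-reflexive (-‿inverseʳ x)
  ... | no  x≰θ = contradiction x≤θ x≰θ

-- Work done before and after a time `θ` in a feasible schedule.

module Workload {c ℓ₁ ℓ₂} (ℝ : RealField c ℓ₁ ℓ₂)
  {n m} (I : Scheduling.Instance ℝ n) (σ : Scheduling.Schedule ℝ n m)
  (feasible : Scheduling.Feasible ℝ I σ) where

  open RealField ℝ hiding (zero)
  open Scheduling ℝ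
  open OrderedField ℝ
  open Sums ℝ
  open Packing ℝ
  open Slots ℝ
  open Truncation ℝ
  open Instance I
  open Feasible feasible

  C : Fin n → Carrier
  C = completion I σ

  q : Fin n → Carrier
  q = size I

  s d : Task n → Carrier
  s = startOf σ
  d = duration I

  -- The plan is a separate argument so that `q-≤` can split on it while keeping an equation for
  -- `σ j`.
  planned : Fin n → Plan m → List (Task n)
  planned j (runUntested _)   = untested j ∷ []
  planned j (testThenRun _ _) = test j ∷ exec j ∷ []

  tasks : Fin n → List (Task n)
  tasks j = planned j (σ j)

  Placed : Task n → Set c
  Placed y = Scheduled σ y (slotOf σ y)

  placed : ∀ {y s} → Scheduled σ y s → Placed y
  placed h = ≡.subst (Scheduled σ _) (≡.sym (slotOf-scheduled h)) h

  tasks-placed : ∀ j → All Placed (tasks j)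
  tasks-placed j with σ j in eq
  ... | runUntested _   = placed (untested eq) ∷ []
  ... | testThenRun _ _ = placed (test eq) ∷ placed (exec eq) ∷ []

  tasks-unique : ∀ j → Unique (tasks j)
  tasks-unique j with σ j
  ... | runUntested _   = [] ∷ []
  ... | testThenRun _ _ = ((λ ()) ∷ []) ∷ [] ∷ []

  tasks-job : ∀ {j y} → y ∈ tasks j → job y ≡ j
  tasks-job {j} y∈ with σ j
  tasks-job (here ≡.refl)         | runUntested _   = ≡.refl
  tasks-job (here ≡.refl)         | testThenRun _ _ = ≡.refl
  tasks-job (there (here ≡.refl)) | testThenRun _ _ = ≡.refl

  tasks-disjoint : ∀ {i j} → i ≢ j → List.Disjoint (tasks i) (tasks j)
  tasks-disjoint i≢j (y∈i , y∈j) = i≢j (≡.trans (≡.sym (tasks-job y∈i)) (tasks-job y∈j))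

  concat-unique : ∀ {S} → Unique S → Unique (concatMap tasks S)
  concat-unique {S} uS = Uniqueₚ.concat⁺ (Allₚ.map⁺ (All.universal tasks-unique S))
    (AllPairsₚ.map⁺ (AllPairs.map tasks-disjoint uS))

  concat-placed : ∀ S → All Placed (concatMap tasks S)
  concat-placed S = Allₚ.concat⁺ (Allₚ.map⁺ (All.universal tasks-placed S))

  test-before-exec : ∀ {j a b} → σ j ≡ testThenRun a b → s (test j) + t j ≤ s (exec j)
  test-before-exec {j} eq = ≡.subst
    (λ plan → start (firstSlot plan) + t j ≤ start (lastSlot plan)) (≡.sym eq) (testFirst eq)

  q≤C : ∀ j → q j ≤ C j
  q≤C j = go (σ j) ≡.refl
    where
    go : ∀ plan → σ j ≡ plan → q j ≤ C j
    go (runUntested _) eq = ≤-trans (x⊓y≤x _ _)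
      (≤-respʳ-≈ (reflexive (≡.sym (completion-untested I σ eq))) (x≤y+x _ (0≤start (placed (untested eq)))))
    go (testThenRun _ _) eq = ≤-trans (x⊓y≤y _ _)
      (≤-respʳ-≈ (reflexive (≡.sym (completion-tested I σ eq))) (+-monoˡ-≤ (p j)
        (≤-trans (x≤y+x _ (0≤start (placed (test eq)))) (test-before-exec eq))))

  module _ (θ : Carrier) (0≤θ : 0# ≤ θ) where

    -- The length of the part of the task's interval that lies before `θ`.
    before : Task n → Carrier
    before y = (s y + d y) ⊓ θ - s y ⊓ θ

    0≤before : ∀ y → 0# ≤ before y
    0≤before y = x≤y⇒0≤y-x (⊓-monoˡ-≤ θ (x≤x+y (s y) (0≤duration I y)))

    s⊓θ+before : ∀ y → s y ⊓ θ + before y ≈ (s y + d y) ⊓ θ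
    s⊓θ+before y = trans (+-comm _ _) (x-y+y≈x _ _)

    module _ (k : Fin m) where

      -- Tasks of other machines become empty intervals at time 0, which are disjoint from all
      -- others since no start is negative. Thus `packing` applies to the whole list of tasks, and
      -- no sublist per machine has to be formed.
      s-on d-on : Task n → Carrier
      s-on y = at (machine (slotOf σ y)) (s y ⊓ θ) k
      d-on y = at (machine (slotOf σ y)) (before y) k

      d-on-nonNeg : ∀ y → 0# ≤ d-on y
      d-on-nonNeg y with machine (slotOf σ y) Finₚ.≟ k
      ... | yes _ = 0≤before y
      ... | no  _ = ≤-refl

      on-within : ∀ {y} → Placed y → Within 0# θ s-on d-on y
      on-within {y} y-placed with machine (slotOf σ y) Finₚ.≟ k
      ... | yes _ = ⊓-glb (0≤start y-placed) 0≤θ ,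
                    ≤-respˡ-≈ (sym (s⊓θ+before y)) (x⊓y≤y _ θ)
      ... | no  _ = ≤-refl , ≤-respˡ-≈ (sym (+-identityˡ 0#)) 0≤θ

      on-disjoint : ∀ {y z} → Placed y → Placed z → y ≢ z → Disjoint s-on d-on y z
      on-disjoint {y} {z} y-placed z-placed y≢z
        with machine (slotOf σ y) Finₚ.≟ k | machine (slotOf σ z) Finₚ.≟ k
      ... | yes y∶k | yes z∶k with oneAtATime y-placed z-placed y≢z (≡.trans y∶k (≡.sym z∶k))
      ...   | inj₁ h = inj₁ (≤-respˡ-≈ (sym (s⊓θ+before y)) (⊓-monoˡ-≤ θ h))
      ...   | inj₂ h = inj₂ (≤-respˡ-≈ (sym (s⊓θ+before z)) (⊓-monoˡ-≤ θ h))
      on-disjoint {y} {z} y-placed z-placed y≢z | yes _ | no _ =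
        inj₂ (≤-respˡ-≈ (sym (+-identityˡ 0#)) (⊓-glb (0≤start y-placed) 0≤θ))
      on-disjoint {y} {z} y-placed z-placed y≢z | no _ | yes _ =
        inj₁ (≤-respˡ-≈ (sym (+-identityˡ 0#)) (⊓-glb (0≤start z-placed) 0≤θ))
      on-disjoint {y} {z} y-placed z-placed y≢z | no _ | no _ =
        inj₁ (≤-reflexive (+-identityˡ 0#))

      load-≤ : ∀ {S} → Unique S → ∑ (concatMap tasks S) d-on ≤ θ
      load-≤ {S} uS = ≤-respˡ-≈ (+-identityˡ _) (packing (concatMap tasks S) s-on d-on 0≤θ d-on-nonNeg
        (All.map (λ {y} → on-within {y}) (concat-placed S))
        (AllPairs-map-with (λ {y} {z} → on-disjoint {y} {z}) (concat-placed S) (concat-unique uS)))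

    before-≤ : ∀ {S} → Unique S → ∑ (concatMap tasks S) before ≤ fromℕ m * θ
    before-≤ {S} uS = ≤-respˡ-≈ (sym (∑-group (concatMap tasks S) (machine ∘ slotOf σ) before))
      (≤-respʳ-≈ (sum-const m θ) (sum-mono-≤ (λ k → load-≤ k uS)))

    -- The work after `θ` is the excess of the end minus the excess of the start; the latter is
    -- moved to the left to avoid subtraction.
    duration-split : ∀ y → d y + excess θ (s y) ≈ before y + excess θ (s y + d y)
    duration-split y = +-cancelʳ-≈ (s y ⊓ θ) (begin
      d y + excess θ (s y) + s y ⊓ θ
        ≈⟨ trans (+-assoc _ _ _) (+-congˡ (trans (+-comm _ _) (⊓+excess θ (s y)))) ⟩
      d y + s y
        ≈⟨ +-comm _ _ ⟩
      s y + d y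
        ≈⟨ ⊓+excess θ (s y + d y) ⟨
      (s y + d y) ⊓ θ + excess θ (s y + d y)
        ≈⟨ +-congʳ (s⊓θ+before y) ⟨
      s y ⊓ θ + before y + excess θ (s y + d y)
        ≈⟨ solve 3 (λ a b c → a :+ b :+ c := b :+ c :+ a) refl _ _ _ ⟩
      before y + excess θ (s y + d y) + s y ⊓ θ ∎)
      where open SetoidReasoning setoid

    -- The work of a job after `θ` telescopes to at most the excess of its completion time, because
    -- the execution starts no earlier than the test ends and `excess` is monotone.
    q-≤ : ∀ j → q j ≤ ∑ (tasks j) before + excess θ (C j)
    q-≤ j = go (σ j) ≡.refl
      where
      open ≤R
      go : ∀ plan → σ j ≡ plan → q j ≤ ∑ (planned j plan) before + excess θ (C j)
      go (runUntested _) eq = begin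
        q j                                                    ≤⟨ x⊓y≤x _ _ ⟩
        u j                                                    ≤⟨ x≤x+y _ (excess-nonNeg θ _) ⟩
        d (untested j) + excess θ (s (untested j))             ≈⟨ duration-split (untested j) ⟩
        before (untested j) + excess θ (s (untested j) + u j)  ≡⟨ ≡.cong (λ x → before (untested j) + excess θ x) (completion-untested I σ eq) ⟨
        before (untested j) + excess θ (C j)                   ≈⟨ +-congʳ (+-identityʳ _) ⟨
        before (untested j) + 0# + excess θ (C j)              ∎
      go (testThenRun _ _) eq = begin
        q j
          ≤⟨ x⊓y≤y _ _ ⟩
        t j + p j
          ≤⟨ t+p≤ ⟩
        before (test j) + (before (exec j) + 0#) + excess θ (s (exec j) + p j)
          ≡⟨ ≡.cong (λ x → before (test j) + (before (exec j) + 0#) + excess θ x) (completion-tested I σ eq) ⟨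
        before (test j) + (before (exec j) + 0#) + excess θ (C j) ∎
        where
        t+p≤ : t j + p j ≤ before (test j) + (before (exec j) + 0#) + excess θ (s (exec j) + p j)
        t+p≤ = linear _ _
          (+-mono-≤ (+-mono-≤ (excess-nonNeg θ (s (test j))) (excess-≤-mono θ (test-before-exec eq)))
            (+-mono-≤ (≤-reflexive (duration-split (test j))) (≤-reflexive (duration-split (exec j)))))
          (solve 8 (λ t p b₁ b₂ c e₁ e₁′ e₂ →
              t :+ p :+ (e₁ :+ e₂ :+ (b₁ :+ e₁′ :+ (b₂ :+ c))) :=
              b₁ :+ (b₂ :+ con 0) :+ c :+ (con 0 :+ e₁′ :+ (t :+ e₁ :+ (p :+ e₂)))) refl
            (t j) (p j) (before (test j)) (before (exec j)) (excess θ (s (exec j) + p j))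
            (excess θ (s (test j))) (excess θ (s (test j) + t j)) (excess θ (s (exec j))))

    workload-≤ : ∀ {S} → Unique S → ∑ S q ≤ fromℕ m * θ + ∑ S (excess θ ∘ C)
    workload-≤ {S} uS = begin
      ∑ S q                                                    ≤⟨ ∑-mono-≤ S q-≤ ⟩
      ∑ S (λ j → ∑ (tasks j) before + excess θ (C j))          ≈⟨ ∑-+ S _ _ ⟩
      ∑ S (λ j → ∑ (tasks j) before) + ∑ S (excess θ ∘ C)      ≈⟨ +-congʳ (∑-concatMap tasks S before) ⟨
      ∑ (concatMap tasks S) before + ∑ S (excess θ ∘ C)        ≤⟨ +-monoˡ-≤ _ (before-≤ uS) ⟩
      fromℕ m * θ + ∑ S (excess θ ∘ C)                         ∎
      where open ≤R

-- Sums of the largest values of a descending list.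

module TopSums {c ℓ₁ ℓ₂} (ℝ : RealField c ℓ₁ ℓ₂) {a} {A : Set a}
  (C : A → RealField.Carrier ℝ)
  (0≤C : ∀ x → RealField._≤_ ℝ (RealField.0# ℝ) (C x)) where

  open RealField ℝ hiding (zero)
  open OrderedField ℝ
  open Sums ℝ
  open Truncation ℝ

  Descending : List A → Set _
  Descending = AllPairs (λ x y → C y ≤ C x)

  top : ℕ → List A → Carrier
  top k l = ∑ (take k l) C

  -- The sum runs over all suffixes: in a list that is descending in completion time, these are the
  -- sets of the first jobs to finish.
  tops : ℕ → List A → Carrier
  tops k []      = 0#
  tops k (x ∷ l) = top k (x ∷ l) + tops k l

  lowerTops : ℕ → List A → Carrier
  lowerTops zero    l = 0#
  lowerTops (suc k) l = lowerTops k l + top k l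

  top-[] : ∀ k → top k [] ≡ 0#
  top-[] zero    = ≡.refl
  top-[] (suc k) = ≡.refl

  lowerTops-[] : ∀ k → lowerTops k [] ≈ 0#
  lowerTops-[] zero    = refl
  lowerTops-[] (suc k) = trans (+-cong (lowerTops-[] k) (reflexive (top-[] k))) (+-identityˡ 0#)

  lowerTops-∷ : ∀ k x l → lowerTops (suc k) (x ∷ l) ≈ fromℕ k * C x + lowerTops k l
  lowerTops-∷ zero    x l = +-congʳ (sym (zeroˡ _))
  lowerTops-∷ (suc k) x l = trans (+-congʳ (lowerTops-∷ k x l))
    (solve 4 (λ k x a b → k :* x :+ a :+ (x :+ b) := (con 1 :+ k) :* x :+ (a :+ b)) refl
      (fromℕ k) (C x) (lowerTops k l) (top k l))

  -- The element at position `i`, counted from 0, lies in `i + 1` suffixes, and `tops` counts it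
  -- `min(i + 1, k + 1)` times. `lowerTops` adds up `top j l` for `j ≤ k` and counts it the missing
  -- `k - i` times, if `i < k`.
  tops+lowerTops : ∀ k l → fromℕ (suc k) * ∑ l C ≈ tops (suc k) l + lowerTops (suc k) l
  tops+lowerTops k []      = trans (zeroʳ _)
    (sym (trans (+-identityˡ _) (lowerTops-[] (suc k))))
  tops+lowerTops k (x ∷ l) = begin
    fromℕ (suc k) * (C x + ∑ l C)
      ≈⟨ distribˡ _ _ _ ⟩
    fromℕ (suc k) * C x + fromℕ (suc k) * ∑ l C
      ≈⟨ +-congˡ (tops+lowerTops k l) ⟩
    fromℕ (suc k) * C x + (tops (suc k) l + (lowerTops k l + top k l))
      ≈⟨ solve 5 (λ k x a b t → (con 1 :+ k) :* x :+ (a :+ (b :+ t)) :=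
           x :+ t :+ a :+ (k :* x :+ b)) refl (fromℕ k) (C x) _ _ (top k l) ⟩
    C x + top k l + tops (suc k) l + (fromℕ k * C x + lowerTops k l)
      ≈⟨ +-congˡ (lowerTops-∷ k x l) ⟨
    C x + top k l + tops (suc k) l + lowerTops (suc k) (x ∷ l) ∎
    where open SetoidReasoning setoid

  top-≤ : ∀ k {l b} → 0# ≤ b → All (λ x → C x ≤ b) l → top k l ≤ fromℕ k * b
  top-≤ zero    {l}     0≤b _  = ≤-reflexive (sym (zeroˡ _))
  top-≤ (suc k) {[]}    0≤b [] = *-nonNeg (fromℕ-nonNeg (suc k)) 0≤b
  top-≤ (suc k) {x ∷ l} {b} 0≤b (x≤b ∷ l≤b) = ≤-respʳ-≈
    (solve 2 (λ k b → b :+ k :* b := (con 1 :+ k) :* b) refl (fromℕ k) b)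
    (+-mono-≤ x≤b (top-≤ k 0≤b l≤b))

  -- Chebyshev's sum inequality for the weights k, k - 1, …, 0.
  lowerTops-≥ : ∀ k {l} → Descending l →
    fromℕ k * top (suc k) l ≤ lowerTops (suc k) l + lowerTops (suc k) l
  lowerTops-≥ k {[]} [] = ≤-reflexive (trans (zeroʳ _)
    (sym (trans (+-cong (lowerTops-[] (suc k)) (lowerTops-[] (suc k))) (+-identityˡ 0#))))
  lowerTops-≥ zero {x ∷ l} _ = ≤-reflexive
    (solve 1 (λ x → con 0 :* x := con 0 :+ con 0 :+ (con 0 :+ con 0)) refl _)
  lowerTops-≥ (suc k) {x ∷ l} (l≤x ∷ desc) = begin
    fromℕ (suc k) * (C x + top (suc k) l)
      ≈⟨ solve 3 (λ k x t → (con 1 :+ k) :* (x :+ t) := (con 1 :+ k) :* x :+ (t :+ k :* t)) refl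
           (fromℕ k) (C x) (top (suc k) l) ⟩
    fromℕ (suc k) * C x + (top (suc k) l + fromℕ k * top (suc k) l)
      ≤⟨ +-monoʳ-≤ _ (+-mono-≤ (top-≤ (suc k) (0≤C x) l≤x) (lowerTops-≥ k desc)) ⟩
    fromℕ (suc k) * C x + (fromℕ (suc k) * C x + (lowerTops (suc k) l + lowerTops (suc k) l))
      ≈⟨ solve 2 (λ a b → a :+ (a :+ (b :+ b)) := a :+ b :+ (a :+ b)) refl _ (lowerTops (suc k) l) ⟩
    fromℕ (suc k) * C x + lowerTops (suc k) l + (fromℕ (suc k) * C x + lowerTops (suc k) l)
      ≈⟨ +-cong (lowerTops-∷ (suc k) x l) (lowerTops-∷ (suc k) x l) ⟨
    lowerTops (suc (suc k)) (x ∷ l) + lowerTops (suc (suc k)) (x ∷ l) ∎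
    where open ≤R

  -- For positive `m`, `θ` is the `m`-th largest value, or 0 if the list is too short. Each of the
  -- first `m` values is then `θ` plus its excess, and later values have no excess. The recursion
  -- passes the value just visited as `b`, which becomes `θ` when `m` is used up.
  top-threshold : ∀ m {l b} → 0# ≤ b → All (λ x → C x ≤ b) l → Descending l →
    ∃ λ θ → 0# ≤ θ × θ ≤ b × fromℕ m * θ + ∑ l (excess θ ∘ C) ≤ top m l
  top-threshold zero {l} {b} 0≤b l≤b _ = b , 0≤b , ≤-refl ,
    ≤-respˡ-≈ (sym (trans (+-congʳ (zeroˡ b)) (+-identityˡ _))) (go l≤b)
    where
    go : ∀ {l} → All (λ x → C x ≤ b) l → ∑ l (excess b ∘ C) ≤ 0#
    go []          = ≤-refl
    go (x≤b ∷ l≤b) = ≤-respʳ-≈ (+-identityˡ 0#) (+-mono-≤ (excess-zero x≤b) (go l≤b))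
  top-threshold (suc m) {[]} 0≤b [] [] = 0# , ≤-refl , 0≤b ,
    ≤-reflexive (trans (+-identityʳ _) (zeroʳ _))
  top-threshold (suc m) {x ∷ l} {b} 0≤b (x≤b ∷ l≤b) (l≤x ∷ desc)
    with top-threshold m (0≤C x) l≤x desc
  ... | θ , 0≤θ , θ≤x , h = θ , 0≤θ , ≤-trans θ≤x x≤b , (begin
    fromℕ (suc m) * θ + (excess θ (C x) + ∑ l (excess θ ∘ C))
      ≈⟨ solve 4 (λ m t e s → (con 1 :+ m) :* t :+ (e :+ s) := t :+ e :+ (m :* t :+ s)) refl
           (fromℕ m) θ _ _ ⟩
    θ + excess θ (C x) + (fromℕ m * θ + ∑ l (excess θ ∘ C))
      ≤⟨ +-mono-≤ (+-monoˡ-≤ _ (⊓-glb θ≤x ≤-refl)) h ⟩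
    C x ⊓ θ + excess θ (C x) + top m l
      ≈⟨ +-congʳ (⊓+excess θ (C x)) ⟩
    C x + top m l ∎)
    where open ≤R

  module _ (q : A → Carrier) where

    pairs : List A → Carrier
    pairs l = ∑ l (λ x → ∑ l (λ y → q x ⊓ q y))

    pairs-↭ : ∀ {l l′} → l ↭ l′ → pairs l ≈ pairs l′
    pairs-↭ {l} {l′} p = trans (∑-↭ _ p) (∑-cong l′ (λ x → ∑-↭ _ p))

    module _ (k : ℕ) (q-≤-top : ∀ {l} → Unique l → Descending l → ∑ l q ≤ top (suc k) l) where

      -- Induction on the list: the head `x` adds a row and a column of the matrix of minima and one
      -- `q x`. Together these are at most twice the total size of `x ∷ l`, which `top` bounds.
      pairs-≤ : ∀ {l} → Unique l → Descending l →
        pairs l + ∑ l q ≤ tops (suc k) l + tops (suc k) l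
      pairs-≤ {[]}    []          []           = ≤-refl
      pairs-≤ {x ∷ l} (x∉l ∷ uni) (l≤x ∷ desc) = begin
        q x ⊓ q x + ∑ l (λ y → q x ⊓ q y) + ∑ l (λ y → q y ⊓ q x + ∑ l (λ z → q y ⊓ q z)) + (q x + ∑ l q)
          ≤⟨ +-monoˡ-≤ _ (+-mono-≤
               (+-mono-≤ (x⊓y≤x _ _) (∑-mono-≤ l (λ y → x⊓y≤y _ _)))
               (∑-mono-≤ l (λ y → +-monoˡ-≤ _ (x⊓y≤x (q y) (q x))))) ⟩
        q x + ∑ l q + ∑ l (λ y → q y + ∑ l (λ z → q y ⊓ q z)) + (q x + ∑ l q)
          ≈⟨ +-congʳ (+-congˡ (∑-+ l _ _)) ⟩
        q x + ∑ l q + (∑ l q + pairs l) + (q x + ∑ l q)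
          ≈⟨ solve 3 (λ a s p → a :+ s :+ (s :+ p) :+ (a :+ s) := a :+ s :+ (a :+ s) :+ (p :+ s)) refl
               (q x) (∑ l q) (pairs l) ⟩
        q x + ∑ l q + (q x + ∑ l q) + (pairs l + ∑ l q)
          ≤⟨ +-mono-≤ (+-mono-≤ q-≤ q-≤) (pairs-≤ uni desc) ⟩
        top (suc k) (x ∷ l) + top (suc k) (x ∷ l) + (tops (suc k) l + tops (suc k) l)
          ≈⟨ solve 2 (λ a b → a :+ a :+ (b :+ b) := a :+ b :+ (a :+ b)) refl
               (top (suc k) (x ∷ l)) (tops (suc k) l) ⟩
        tops (suc k) (x ∷ l) + tops (suc k) (x ∷ l) ∎
        where
        open ≤R
        q-≤ : q x + ∑ l q ≤ top (suc k) (x ∷ l)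
        q-≤ = q-≤-top (x∉l ∷ uni) (l≤x ∷ desc)

      -- Of the `k + 1` copies of the total size, one is absorbed by `pairs-≤` and the other `k` by
      -- `lowerTops-≥`.
      sum-≥ : ∀ {l} → Unique l → Descending l →
        pairs l + fromℕ (suc k) * ∑ l q ≤ fromℕ (suc k) * ∑ l C + fromℕ (suc k) * ∑ l C
      sum-≥ {l} uni desc = begin
        pairs l + fromℕ (suc k) * ∑ l q
          ≈⟨ solve 3 (λ p k s → p :+ (con 1 :+ k) :* s := p :+ s :+ k :* s) refl
               (pairs l) (fromℕ k) (∑ l q) ⟩
        pairs l + ∑ l q + fromℕ k * ∑ l q
          ≤⟨ +-mono-≤ (pairs-≤ uni desc) (≤-trans
               (*-monoˡ-≤ (fromℕ-nonNeg k) (q-≤-top uni desc)) (lowerTops-≥ k desc)) ⟩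
        tops (suc k) l + tops (suc k) l + (lowerTops (suc k) l + lowerTops (suc k) l)
          ≈⟨ solve 2 (λ a b → a :+ a :+ (b :+ b) := a :+ b :+ (a :+ b)) refl
               (tops (suc k) l) (lowerTops (suc k) l) ⟩
        tops (suc k) l + lowerTops (suc k) l + (tops (suc k) l + lowerTops (suc k) l)
          ≈⟨ +-cong (tops+lowerTops k l) (tops+lowerTops k l) ⟨
        fromℕ (suc k) * ∑ l C + fromℕ (suc k) * ∑ l C ∎
        where open ≤R

-- The lower bound on the optimum.

module LowerBound {c ℓ₁ ℓ₂} (ℝ : RealField c ℓ₁ ℓ₂)
  {n k} (I : Scheduling.Instance ℝ n) (σ : Scheduling.Schedule ℝ n (suc k))
  (feasible : Scheduling.Feasible ℝ I σ) where

  open RealField ℝ hiding (zero)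
  open Scheduling ℝ
  open OrderedField ℝ
  open Sums ℝ
  open Slots ℝ
  open Truncation ℝ
  open Workload ℝ I σ feasible using (C; q; q≤C; workload-≤)

  0≤C : ∀ j → 0# ≤ C j
  0≤C j = ≤-trans (size-nonNeg I j) (q≤C j)

  open TopSums ℝ C 0≤C

  -- The work of the jobs in l after time θ is at most the sum of the excesses
  -- over θ of their completion times, and before θ at most m θ.
  q-≤-top : ∀ {l} → Unique l → Descending l → ∑ l q ≤ top (suc k) l
  q-≤-top {[]}    _   _ = ≤-refl
  q-≤-top {x ∷ l} uni desc@(l≤x ∷ _) = go (top-threshold (suc k) (0≤C x) (≤-refl ∷ l≤x) desc)
    where
    go : (∃ λ θ → 0# ≤ θ × θ ≤ C x ×
            fromℕ (suc k) * θ + ∑ (x ∷ l) (excess θ ∘ C) ≤ top (suc k) (x ∷ l)) →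
         ∑ (x ∷ l) q ≤ top (suc k) (x ∷ l)
    go (θ , 0≤θ , _ , h) = ≤-trans (workload-≤ θ 0≤θ uni) h

  latestFirst : DecTotalOrder 0ℓ ℓ₁ ℓ₂
  latestFirst = On.decTotalOrder (Flip.decTotalOrder decTotalOrder) C

  open Sort latestFirst using (sort; sort-↭; sort-↗)

  jobs : List (Fin n)
  jobs = sort (allFin n)

  jobs-↭ : jobs ↭ allFin n
  jobs-↭ = sort-↭ (allFin n)

  jobs-unique : Unique jobs
  jobs-unique = ↭ₛ.Unique-resp-↭ (≡.setoid (Fin n)) (↭⇒↭ₛ (↭.↭-sym jobs-↭)) (Uniqueₚ.allFin⁺ n)

  jobs-descending : Descending jobs
  jobs-descending = Linkedₚ.Linked⇒AllPairs (flip ≤-trans) (sort-↗ (allFin n))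

  sum-jobs : ∀ (f : Fin n → Carrier) → ∑ jobs f ≈ sum f
  sum-jobs f = trans (∑-↭ f jobs-↭) (∑-allFin f)

  size≤cost : sum q ≤ cost I σ
  size≤cost = sum-mono-≤ q≤C

  cost-≥ : sum (λ i → sum (λ j → q i ⊓ q j)) + fromℕ (suc k) * sum q ≤
           fromℕ (suc k) * cost I σ + fromℕ (suc k) * cost I σ
  cost-≥ = ≤-respˡ-≈ (+-cong pairs≈ (*-congˡ (sum-jobs q)))
    (≤-respʳ-≈ (+-cong (*-congˡ (sum-jobs C)) (*-congˡ (sum-jobs C)))
      (sum-≥ q k q-≤-top jobs-unique jobs-descending))
    where
    pairs≈ : pairs q jobs ≈ sum (λ i → sum (λ j → q i ⊓ q j))
    pairs≈ = trans (pairs-↭ q jobs-↭) (trans (∑-cong (allFin n) (λ i → ∑-allFin (λ j → q i ⊓ q j)))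
      (∑-allFin (λ i → sum (λ j → q i ⊓ q j))))

-- Invariants of a run of the algorithm.

module Run {c ℓ₁ ℓ₂} (ℝ : RealField c ℓ₁ ℓ₂) (α β : RealField.Carrier ℝ)
  {n m} (I : Scheduling.Instance ℝ n) (σ : Scheduling.Schedule ℝ n m) where

  open RealField ℝ hiding (zero)
  open Scheduling ℝ
  open OrderedField ℝ
  open Sums ℝ
  open Slots ℝ
  open Instance I

  w d s : Task n → Carrier
  w = weight α β I
  d = duration I
  s = startOf σ

  Mach : Set c
  Mach = Machine α β n

  idle halted : Mach
  idle   = until 0# nothing
  halted = stopped

  until≢stopped : ∀ {M : Mach} {τ x} → M ≡ until τ x → M ≢ stopped
  until≢stopped ≡.refl ()

  idle-not-testing : ∀ {M : Mach} {τ i} → M ≡ idle → M ≢ until τ (just (test i))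
  idle-not-testing ≡.refl ()

  data Admissible (H : List (Task n)) : Task n → Set where
    untested : ∀ {j} → initialTask α β I j ≡ untested j → Admissible H (untested j)
    test     : ∀ {j} → initialTask α β I j ≡ test j → Admissible H (test j)
    exec     : ∀ {j} → initialTask α β I j ≡ test j → test j ∈ H → Admissible H (exec j)

  -- The second component expresses that no machine has idled before the start of `y`: the tasks of
  -- `H` then fill all `m` machines up to that time.
  Early : List (Task n) → Task n → Set ℓ₂
  Early H y = All (λ z → w z ≤ w y) H × fromℕ m * s y ≤ ∑ H d

  data Immediate : Task n → Set ℓ₁ where
    exec : ∀ {j} → s (exec j) ≈ s (test j) + t j → Immediate (exec j)

  record Entry (H : List (Task n)) (y : Task n) : Set (c ⊔ ℓ₁ ⊔ ℓ₂) where
    field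
      admissible : Admissible H y
      scheduled  : Scheduled σ y (slotOf σ y)
      timely     : Early H y ⊎ Immediate y

  -- The most recently started task comes first.
  data History : List (Task n) → Set (c ⊔ ℓ₁ ⊔ ℓ₂) where
    []  : History []
    _∷_ : ∀ {y H} → Entry H y → History H → History (y ∷ H)

  weaken : ∀ {H y z} → Admissible H y → Admissible (z ∷ H) y
  weaken (untested eq) = untested eq
  weaken (test eq)     = test eq
  weaken (exec eq h)   = exec eq (there h)

  started-admissible : ∀ {H y} → History H → y ∈ H → Admissible H y
  started-admissible (e ∷ h) (here ≡.refl) = weaken (Entry.admissible e)
  started-admissible (e ∷ h) (there y∈H)   = weaken (started-admissible h y∈H)

  follow : Task n → List (Task n)
  follow (test j)     = exec j ∷ []
  follow (untested j) = []
  follow (exec j)     = []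

  -- Adds to each test the execution that it will insert. With this and `pending`, the tasks
  -- started, queued or still to be inserted form the same multiset throughout the run.
  expand : List (Task n) → List (Task n)
  expand = concatMap (λ y → y ∷ follow y)

  followLast : Maybe (Task n) → List (Task n)
  followLast (just y) = follow y
  followLast nothing  = []

  upcoming : Mach → List (Task n)
  upcoming (until _ x) = followLast x
  upcoming stopped     = []

  pending : ∀ {k} → Vec Mach k → List (Task n)
  pending []       = []
  pending (M ∷ ms) = upcoming M ++ pending ms

  -- `rest` does not depend on `M`, so the machines before and after a step can be compared.
  pending-update : ∀ {k} (ms : Vec Mach k) i →
    ∃ λ rest → ∀ M → pending (ms [ i ]≔ M) ↭ upcoming M ++ rest
  pending-update (M ∷ ms) zero    = pending ms , λ _ → ↭-refl
  pending-update (M ∷ ms) (suc i) with pending-update ms i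
  ... | rest , h = upcoming M ++ rest , λ M′ →
    ↭-trans (↭ₚ.++⁺ˡ (upcoming M) (h M′)) (↭ₚ.shifts (upcoming M) (upcoming M′))

  expand-↭ : ∀ {l l′} → l ↭ l′ → expand l ↭ expand l′
  expand-↭ ↭.refl          = ↭.refl
  expand-↭ (↭.prep x p)    = ↭ₚ.++⁺ˡ (x ∷ follow x) (expand-↭ p)
  expand-↭ (↭.swap x y p)  = ↭-trans (↭ₚ.shifts (x ∷ follow x) (y ∷ follow y))
    (↭ₚ.++⁺ˡ (y ∷ follow y) (↭ₚ.++⁺ˡ (x ∷ follow x) (expand-↭ p)))
  expand-↭ (↭.trans p₁ p₂) = ↭-trans (expand-↭ p₁) (expand-↭ p₂)

  expand-insert : ∀ x q → followLast x ++ expand q ≡ expand (insertAfter α β x q)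
  expand-insert nothing             q = ≡.refl
  expand-insert (just (untested _)) q = ≡.refl
  expand-insert (just (test _))     q = ≡.refl
  expand-insert (just (exec _))     q = ≡.refl

  NoStop : Vec Mach m → Set c
  NoStop ms = ∀ k → lookup ms k ≢ stopped

  busy : Mach → Carrier
  busy (until τ _) = τ
  busy stopped     = 0#

  -- `threshold` persists because a machine that becomes idle inserts at most one
  -- task: if it is the only one of weight at most v, it is also the one that is
  -- picked.  `load` holds because a machine is never idle before it is stopped.
  record Invariant (ms : Vec Mach m) (q H : List (Task n)) : Set (c ⊔ ℓ₁ ⊔ ℓ₂) where
    field
      history    : History H
      threshold  : ∀ v → (All (λ y → w y ≤ v) H × NoStop ms) ⊎ All (λ y → v < w y) q
      load       : NoStop ms → sum (λ k → busy (lookup ms k)) ≈ ∑ H d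
      running    : ∀ k {τ i} → lookup ms k ≡ until τ (just (test i)) →
                   test i ∈ H × τ ≈ s (test i) + t i
      queued     : All (Admissible H) q
      accounting : H ++ (expand q ++ pending ms) ↭ expand (map (initialTask α β I) (allFin n))

  pending-initial : ∀ k → pending (replicate k idle) ≡ []
  pending-initial zero    = ≡.refl
  pending-initial (suc k) = pending-initial k

  pending-final : ∀ k → pending (replicate k halted) ≡ []
  pending-final zero    = ≡.refl
  pending-final (suc k) = pending-final k

  initial-admissible : ∀ j → Admissible [] (initialTask α β I j)
  initial-admissible j = go _ (initialTask-cases j) ≡.refl
    where
    initialTask-cases : ∀ j → initialTask α β I j ≡ test j ⊎ initialTask α β I j ≡ untested j
    initialTask-cases j with α * t j ≤? u j
    ... | yes _ = inj₁ ≡.refl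
    ... | no  _ = inj₂ ≡.refl
    go : ∀ y → initialTask α β I j ≡ test j ⊎ initialTask α β I j ≡ untested j →
         initialTask α β I j ≡ y → Admissible [] y
    go y (inj₁ eq) eq′ = ≡.subst (Admissible []) (≡.trans (≡.sym eq) eq′) (test eq)
    go y (inj₂ eq) eq′ = ≡.subst (Admissible []) (≡.trans (≡.sym eq) eq′) (untested eq)

  initial-invariant : Invariant (replicate m idle) (map (initialTask α β I) (allFin n)) []
  initial-invariant = record
    { history    = []
    ; threshold  = λ v → inj₁ ([] , λ k → until≢stopped (Vecₚ.lookup-replicate k idle))
    ; load       = λ _ → trans (sum-cong-≋ {m} (λ k → reflexive (≡.cong busy (Vecₚ.lookup-replicate k idle))))
                     (sum-replicate-zero m)
    ; running    = λ k eq → contradiction eq (idle-not-testing (Vecₚ.lookup-replicate k idle))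
    ; queued     = Allₚ.map⁺ (All.universal initial-admissible (allFin n))
    ; accounting = ↭-reflexive (≡.trans (≡.cong (expand (map (initialTask α β I) (allFin n)) ++_) (pending-initial m)) (Listₚ.++-identityʳ _))
    }

  picked : ∀ (x : Maybe (Task n)) {q y rest} → insertAfter α β x q ↭ y ∷ rest →
    (∃ λ i → x ≡ just (test i) × y ≡ exec i × rest ↭ q) ⊎ (y ∈ q)
  picked nothing             p = inj₂ (↭ₚ.∈-resp-↭ (↭-sym p) (here ≡.refl))
  picked (just (untested _)) p = inj₂ (↭ₚ.∈-resp-↭ (↭-sym p) (here ≡.refl))
  picked (just (exec _))     p = inj₂ (↭ₚ.∈-resp-↭ (↭-sym p) (here ≡.refl))
  picked (just (test i))     p with ↭ₚ.∈-resp-↭ (↭-sym p) (here ≡.refl)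
  ... | here ≡.refl = inj₁ (i , ≡.refl , ≡.refl , ↭-sym (↭ₚ.drop-∷ p))
  ... | there y∈q   = inj₂ y∈q

  module _ {ms q H} (inv : Invariant ms q H) {k τ x} (next : NextIdle α β ms k τ x) where
    open Invariant inv

    NoStop-restrict : ∀ {M} → NoStop (ms [ k ]≔ M) → NoStop ms
    NoStop-restrict ns k′ with k′ Finₚ.≟ k
    ... | yes ≡.refl = until≢stopped (proj₁ next)
    ... | no  k′≢k   = λ eq → ns k′ (≡.trans (Vecₚ.lookup∘update′ k′≢k ms _) eq)

    -- The machine being served is the first to become idle, so all `m` busy times are at least `τ`,
    -- and `load` gives their sum.
    idle-≤ : NoStop ms → fromℕ m * τ ≤ ∑ H d
    idle-≤ ns = ≤-respˡ-≈ (sum-const m τ) (≤-respʳ-≈ (load ns)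
      (sum-mono-≤ (λ k′ → go k′ (lookup ms k′) ≡.refl)))
      where
      go : ∀ k′ M → lookup ms k′ ≡ M → τ ≤ busy (lookup ms k′)
      go k′ (until τ′ x′) eq = ≤-respʳ-≈ (reflexive (≡.cong busy (≡.sym eq))) (proj₂ next k′ τ′ x′ eq)
      go k′ stopped       eq = contradiction eq (ns k′)

    insert-admissible : All (Admissible H) (insertAfter α β x q)
    insert-admissible = go x (proj₁ next)
      where
      go : ∀ x → lookup ms k ≡ until τ x → All (Admissible H) (insertAfter α β x q)
      go nothing             _  = queued
      go (just (untested _)) _  = queued
      go (just (exec _))     _  = queued
      go (just (test i))     eq with proj₁ (running k eq)
      ... | i∈H with started-admissible history i∈H
      ...   | test eq′ = exec eq′ i∈H ∷ queued

    -- The multiset is conserved: the execution following `x`, if any, passes from the machine to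
    -- the queue, `y` from the queue to the history, and the execution following `y` from the
    -- expanded queue to the machine.
    rearrange : ∀ {y rest M} → insertAfter α β x q ↭ y ∷ rest → upcoming M ≡ follow y →
      H ++ (expand q ++ pending ms) ↭ (y ∷ H) ++ (expand rest ++ pending (ms [ k ]≔ M))
    rearrange {y} {rest} {M} p up = begin
      H ++ (expand q ++ pending ms)
        ≡⟨ ≡.cong (λ v → H ++ (expand q ++ pending v)) (Vecₚ.[]≔-lookup ms k) ⟨
      H ++ (expand q ++ pending (ms [ k ]≔ lookup ms k))
        ↭⟨ ↭ₚ.++⁺ˡ H (↭ₚ.++⁺ˡ (expand q) (h (lookup ms k))) ⟩
      H ++ (expand q ++ (upcoming (lookup ms k) ++ R))
        ≡⟨ ≡.cong (λ v → H ++ (expand q ++ (upcoming v ++ R))) (proj₁ next) ⟩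
      H ++ (expand q ++ (followLast x ++ R))
        ↭⟨ ↭ₚ.++⁺ˡ H (↭ₚ.shifts (expand q) (followLast x)) ⟩
      H ++ (followLast x ++ (expand q ++ R))
        ≡⟨ ≡.cong (H ++_) (≡.trans (≡.sym (Listₚ.++-assoc (followLast x) _ _)) (≡.cong (_++ R) (expand-insert x q))) ⟩
      H ++ (expand (insertAfter α β x q) ++ R)
        ↭⟨ ↭ₚ.++⁺ˡ H (↭ₚ.++⁺ʳ R (expand-↭ p)) ⟩
      H ++ (y ∷ (follow y ++ expand rest) ++ R)
        ↭⟨ ↭ₚ.shift y H _ ⟩
      y ∷ H ++ ((follow y ++ expand rest) ++ R)
        ≡⟨ ≡.cong (λ v → y ∷ H ++ v) (Listₚ.++-assoc (follow y) _ _) ⟩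
      y ∷ H ++ (follow y ++ (expand rest ++ R))
        ↭⟨ ↭ₚ.++⁺ˡ (y ∷ H) (↭ₚ.shifts (follow y) (expand rest)) ⟩
      y ∷ H ++ (expand rest ++ (follow y ++ R))
        ≡⟨ ≡.cong (λ v → y ∷ H ++ (expand rest ++ (v ++ R))) up ⟨
      y ∷ H ++ (expand rest ++ (upcoming M ++ R))
        ↭⟨ ↭ₚ.++⁺ˡ (y ∷ H) (↭ₚ.++⁺ˡ (expand rest) (h M)) ⟨
      y ∷ H ++ (expand rest ++ pending (ms [ k ]≔ M)) ∎
      where
      open ↭.PermutationReasoning
      R : List (Task n)
      R = proj₁ (pending-update ms k)
      h : ∀ M → pending (ms [ k ]≔ M) ↭ upcoming M ++ R
      h = proj₂ (pending-update ms k)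

    module _ {y rest} (p : insertAfter α β x q ↭ y ∷ rest)
      (least : All (λ z → w y ≤ w z) rest) (sch : Scheduled σ y (slot k τ)) where

      ms′ : Vec Mach m
      ms′ = ms [ k ]≔ until (τ + d y) (just y)

      start≡τ : s y ≡ τ
      start≡τ = ≡.cong start (slotOf-scheduled sch)

      NoStop-run : NoStop ms → NoStop ms′
      NoStop-run ns k′ with k′ Finₚ.≟ k
      ... | yes ≡.refl = until≢stopped (Vecₚ.lookup∘update k ms _)
      ... | no  k′≢k   = λ eq → ns k′ (≡.trans (≡.sym (Vecₚ.lookup∘update′ k′≢k ms _)) eq)

      -- `threshold` is applied at the weight of `y` itself. If all tasks that were waiting are
      -- heavier, `y` must be the execution inserted at this very moment, so it starts when its test
      -- ends.
      timely-run : Early H y ⊎ Immediate y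
      timely-run = go (threshold (w y)) (picked x p)
        where
        go : (All (λ z → w z ≤ w y) H × NoStop ms) ⊎ All (λ z → w y < w z) q →
             (∃ λ i → x ≡ just (test i) × y ≡ exec i × rest ↭ q) ⊎ (y ∈ q) →
             Early H y ⊎ Immediate y
        go (inj₁ (H≤ , ns)) _ = inj₁ (H≤ , ≤-respˡ-≈ (*-congˡ (reflexive (≡.sym start≡τ))) (idle-≤ ns))
        go (inj₂ q>) (inj₂ y∈q) = contradiction ≤-refl (<⇒≱ (All.lookup q> y∈q))
        go (inj₂ q>) (inj₁ (i , x≡ , ≡.refl , _)) = inj₂ (exec (trans (reflexive start≡τ)
          (proj₂ (running k (≡.subst (λ z → lookup ms k ≡ until τ z) x≡ (proj₁ next))))))

      threshold-run : ∀ v → (All (λ z → w z ≤ v) (y ∷ H) × NoStop ms′) ⊎ All (λ z → v < w z) rest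
      threshold-run v = go (threshold v) (picked x p)
        where
        go : (All (λ z → w z ≤ v) H × NoStop ms) ⊎ All (λ z → v < w z) q →
             (∃ λ i → x ≡ just (test i) × y ≡ exec i × rest ↭ q) ⊎ (y ∈ q) →
             (All (λ z → w z ≤ v) (y ∷ H) × NoStop ms′) ⊎ All (λ z → v < w z) rest
        go (inj₁ (H≤ , ns)) _ with w y ≤? v
        ... | yes wy≤v = inj₁ (wy≤v ∷ H≤ , NoStop-run ns)
        ... | no  wy≰v = inj₂ (All.map (<-≤-trans (≰⇒> wy≰v)) least)
        go (inj₂ q>) (inj₁ (_ , _ , _ , rest↭q)) = inj₂ (↭ₚ.All-resp-↭ (↭-sym rest↭q) q>)
        go (inj₂ q>) (inj₂ y∈q) = inj₂ (All.map (<-≤-trans (All.lookup q> y∈q)) least)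

      load-run : NoStop ms′ → sum (λ k → busy (lookup ms′ k)) ≈ d y + ∑ H d
      load-run ns = trans (sum-cong-≋ {m} pointwise) (trans (∑-distrib-+ {m} (at k (d y)) _)
        (+-cong (sum-at k (d y)) (load (NoStop-restrict ns))))
        where
        pointwise : ∀ k′ → busy (lookup ms′ k′) ≈ at k (d y) k′ + busy (lookup ms k′)
        pointwise k′ with k Finₚ.≟ k′
        ... | yes ≡.refl = trans (reflexive (≡.cong busy (Vecₚ.lookup∘update k ms _)))
          (trans (+-comm _ _) (+-congˡ (reflexive (≡.cong busy (≡.sym (proj₁ next))))))
        ... | no  k≢k′ = trans (reflexive (≡.cong busy (Vecₚ.lookup∘update′ (k≢k′ ∘ ≡.sym) ms _)))
          (sym (+-identityˡ _))

      running-run : ∀ k′ {τ′ i} → lookup ms′ k′ ≡ until τ′ (just (test i)) →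
                    test i ∈ (y ∷ H) × τ′ ≈ s (test i) + t i
      running-run k′ eq with k′ Finₚ.≟ k
      ... | yes ≡.refl = go (≡.trans (≡.sym (Vecₚ.lookup∘update k ms _)) eq) start≡τ
        where
        go : ∀ {y τ₀ τ′ i} → until (τ₀ + d y) (just y) ≡ until τ′ (just (test i)) → s y ≡ τ₀ →
             test i ∈ (y ∷ H) × τ′ ≈ s (test i) + t i
        go ≡.refl sy≡τ = here ≡.refl , +-congʳ (reflexive (≡.sym sy≡τ))
      ... | no k′≢k = let i∈H , τ′≈ = running k′ (≡.trans (≡.sym (Vecₚ.lookup∘update′ k′≢k ms _)) eq)
                      in there i∈H , τ′≈

      run-invariant : Invariant ms′ rest (y ∷ H)
      run-invariant = record
        { history    = record
          { admissible = All.head adm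
          ; scheduled  = ≡.subst (Scheduled σ y) (≡.sym (slotOf-scheduled sch)) sch
          ; timely     = timely-run
          } ∷ history
        ; threshold  = threshold-run
        ; load       = load-run
        ; running    = running-run
        ; queued     = All.map weaken (All.tail adm)
        ; accounting = ↭-trans (↭-sym (rearrange p ≡.refl)) accounting
        }
        where
        adm : All (Admissible H) (y ∷ rest)
        adm = ↭ₚ.All-resp-↭ p insert-admissible

    insert-[] : ∀ x → insertAfter α β x q ≡ [] → q ≡ [] × followLast x ≡ []
    insert-[] nothing             eq = eq , ≡.refl
    insert-[] (just (untested _)) eq = eq , ≡.refl
    insert-[] (just (exec _))     eq = eq , ≡.refl

    stop-invariant : insertAfter α β x q ≡ [] → Invariant (ms [ k ]≔ stopped) [] H
    stop-invariant eq = record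
      { history    = history
      ; threshold  = λ v → inj₂ []
      ; load       = λ ns → contradiction (Vecₚ.lookup∘update k ms stopped) (ns k)
      ; running    = running-stop
      ; queued     = []
      ; accounting = ↭-trans (↭ₚ.++⁺ˡ H (↭-sym shrink)) accounting
      }
      where
      running-stop : ∀ k′ {τ′ i} → lookup (ms [ k ]≔ stopped) k′ ≡ until τ′ (just (test i)) →
                     test i ∈ H × τ′ ≈ s (test i) + t i
      running-stop k′ eq with k′ Finₚ.≟ k
      ... | yes ≡.refl = contradiction (Vecₚ.lookup∘update k ms halted) (until≢stopped eq)
      ... | no  k′≢k   = running k′ (≡.trans (≡.sym (Vecₚ.lookup∘update′ k′≢k ms _)) eq)
      shrink : expand q ++ pending ms ↭ pending (ms [ k ]≔ stopped)
      shrink = begin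
        expand q ++ pending ms
          ≡⟨ ≡.cong₂ (λ l v → expand l ++ pending v) (proj₁ (insert-[] x eq)) (≡.sym (Vecₚ.[]≔-lookup ms k)) ⟩
        pending (ms [ k ]≔ lookup ms k)
          ↭⟨ h (lookup ms k) ⟩
        upcoming (lookup ms k) ++ R
          ≡⟨ ≡.cong (_++ R) (≡.trans (≡.cong upcoming (proj₁ next)) (proj₂ (insert-[] x eq))) ⟩
        R
          ↭⟨ h stopped ⟨
        pending (ms [ k ]≔ stopped) ∎
        where
        open ↭.PermutationReasoning
        R : List (Task n)
        R = proj₁ (pending-update ms k)
        h : ∀ M → pending (ms [ k ]≔ M) ↭ upcoming M ++ R
        h = proj₂ (pending-update ms k)

  preserved : ∀ {ms q ms′ q′} → Star (Step α β I σ) (ms , q) (ms′ , q′) →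
    (∃ λ H → Invariant ms q H) → ∃ λ H → Invariant ms′ q′ H
  preserved ε inv = inv
  preserved (run next p least sch ◅ rest) (H , inv) =
    preserved rest (_ , run-invariant inv next p least sch)
  preserved (stop next eq ◅ rest) (H , inv) = preserved rest (H , stop-invariant inv next eq)

  -- In the final state the queue is empty and no execution is pending, so only the history is left
  -- in `accounting`.
  complete-history : PCPM α β I σ →
    ∃ λ H → History H × H ↭ expand (map (initialTask α β I) (allFin n))
  complete-history steps = let H , inv = preserved steps ([] , initial-invariant) in
    H , Invariant.history inv ,
    ≡.subst (_↭ _) (≡.trans (≡.cong (H ++_) (pending-final m)) (Listₚ.++-identityʳ H)) (Invariant.accounting inv)

-- Positions in a list.

module _ {a} {A : Set a} where

  -- A history has its latest start first, so the tail behind an occurrence holds the tasks started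
  -- earlier, and `rank` counts them.
  past : ∀ {x : A} {l} → x ∈ l → List A
  past {l = _ ∷ l} (here _)  = l
  past             (there p) = past p

  rank : ∀ {x : A} {l} → x ∈ l → ℕ
  rank p = length (past p)

  rank<length : ∀ {x : A} {l} (p : x ∈ l) → rank p ℕ.< length l
  rank<length (here _)  = ℕₚ.≤-refl
  rank<length (there p) = ℕₚ.m≤n⇒m≤1+n (rank<length p)

  past-⊆ : ∀ {x y : A} {l} (p : x ∈ l) → y ∈ past p → y ∈ l
  past-⊆ (here _)  y∈ = there y∈
  past-⊆ (there p) y∈ = there (past-⊆ p y∈)

  past-unique : ∀ {x : A} {l} → Unique l → (p : x ∈ l) → Unique (past p)
  past-unique (_ ∷ uni) (here _)  = uni
  past-unique (_ ∷ uni) (there p) = past-unique uni p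

  rank-past : ∀ {x y : A} {l} → Unique l → (p : x ∈ l) → y ∈ past p → (r : y ∈ l) → rank r ℕ.< rank p
  rank-past (x∉ ∷ _) (here ≡.refl) y∈ (here ≡.refl) = contradiction ≡.refl (All.lookup x∉ y∈)
  rank-past _        (here _)      y∈ (there r)     = rank<length r
  rank-past (y∉ ∷ _) (there p)     y∈ (here ≡.refl) = contradiction ≡.refl (All.lookup y∉ (past-⊆ p y∈))
  rank-past (_ ∷ uni) (there p)    y∈ (there r)     = rank-past uni p y∈ r

-- Inequalities for the parameters and for a single job.

module Parameters {c ℓ₁ ℓ₂} (ℝ : RealField c ℓ₁ ℓ₂) where
  open RealField ℝ hiding (zero)

  record Balanced (φ β : Carrier) : Set (ℓ₁ ⊔ ℓ₂) where
    field
      1≤φ    : 1# ≤ φ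
      φ²     : φ * φ ≈ φ + 1#
      β²     : β * β ≈ φ * β + φ
      2≤β    : fromℕ 2 ≤ β
      φ≤β    : φ ≤ β
      2φ≤β+1 : φ + φ ≤ β + 1#

module JobArithmetic {c ℓ₁ ℓ₂} (ℝ : RealField c ℓ₁ ℓ₂) {φ β : RealField.Carrier ℝ}
  (balanced : Parameters.Balanced ℝ φ β) where

  open RealField ℝ hiding (zero)
  open OrderedField ℝ
  open Parameters.Balanced balanced

  0≤φ : 0# ≤ φ
  0≤φ = ≤-trans 0≤1 1≤φ

  1≤β : 1# ≤ β
  1≤β = ≤-trans 1≤φ φ≤β

  0<β : 0# < β
  0<β = 1≤⇒0< 1≤β

  0≤β : 0# ≤ β
  0≤β = proj₁ 0<β

  x≤φx : ∀ {x} → 0# ≤ x → x ≤ φ * x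
  x≤φx 0≤x = ≤-respˡ-≈ (*-identityˡ _) (*-monoʳ-≤ 0≤x 1≤φ)

  x≤βx : ∀ {x} → 0# ≤ x → x ≤ β * x
  x≤βx 0≤x = ≤-trans (x≤φx 0≤x) (*-monoʳ-≤ 0≤x φ≤β)

  -- `x ≤ y / φ` gives `x + y ≤ (1 + 1/φ) y`, and `1 + 1/φ = φ`.
  φx≤y⇒x+y≤φy : ∀ {x y} → φ * x ≤ y → x + y ≤ φ * y
  φx≤y⇒x+y≤φy {x} {y} h = *-cancelˡ-≤ (1≤⇒0< 1≤φ) (begin
    φ * (x + y)   ≈⟨ distribˡ φ x y ⟩
    φ * x + φ * y ≤⟨ +-monoˡ-≤ (φ * y) h ⟩
    y + φ * y     ≈⟨ solve 2 (λ f y → y :+ f :* y := (f :+ con 1) :* y) refl φ y ⟩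
    (φ + 1#) * y  ≈⟨ *-congʳ φ² ⟨
    φ * φ * y     ≈⟨ *-assoc φ φ y ⟩
    φ * (φ * y)   ∎)
    where open ≤R

  -- `a + b ≤ (1 + 1/β) a ≤ (1 + 1/β) φ q`, and `(1 + 1/β) φ = β` is the equation that determines
  -- `β`.
  combined-≤ : ∀ {a b q} → a ≤ φ * q → β * b ≤ a → a + b ≤ β * q
  combined-≤ {a} {b} {q} a≤φq βb≤a = *-cancelˡ-≤ 0<β (begin
    β * (a + b)        ≈⟨ distribˡ β a b ⟩
    β * a + β * b      ≤⟨ +-monoʳ-≤ (β * a) βb≤a ⟩
    β * a + a          ≈⟨ solve 2 (λ b a → b :* a :+ a := (b :+ con 1) :* a) refl β a ⟩
    (β + 1#) * a       ≤⟨ *-monoˡ-≤ (+-nonNeg 0≤β 0≤1) a≤φq ⟩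
    (β + 1#) * (φ * q) ≈⟨ solve 3 (λ b f q → (b :+ con 1) :* (f :* q) := (f :* b :+ f) :* q) refl β φ q ⟩
    (φ * β + φ) * q    ≈⟨ *-congʳ β² ⟨
    β * β * q          ≈⟨ *-assoc β β q ⟩
    β * (β * q)        ∎)
    where open ≤R

  module _ {t u p} (0≤t : 0# ≤ t) (0≤u : 0# ≤ u) (0≤p : 0# ≤ p) (p≤u : p ≤ u) where

    untested-≤ : ¬ φ * t ≤ u → u ≤ φ * (u ⊓ (t + p))
    untested-≤ ¬φt≤u = *-glb-⊓ (x≤φx 0≤u)
      (≤-trans (≰⇒≥ ¬φt≤u) (*-monoˡ-≤ 0≤φ (x≤x+y t 0≤p)))

    module _ (φt≤u : φ * t ≤ u) where

      test-≤ : t ≤ u ⊓ (t + p)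
      test-≤ = ⊓-glb (≤-trans (x≤φx 0≤t) φt≤u) (x≤x+y t 0≤p)

      tested-≤ : t + p ≤ φ * (u ⊓ (t + p))
      tested-≤ = *-glb-⊓ (≤-trans (+-monoʳ-≤ t p≤u) (φx≤y⇒x+y≤φy φt≤u)) (x≤φx (+-nonNeg 0≤t 0≤p))

      -- Against `u`: `2t ≤ 2(φ - 1) u` and `p ≤ u` give `(2φ - 1) u`, which is at most `β u`.
      -- Against `t + p`: the left side is at most twice that, and `2 ≤ β`.
      test+tested-≤ : t + (t + p) ≤ β * (u ⊓ (t + p))
      test+tested-≤ = *-glb-⊓
        (linear _ _ (+-mono-≤ (+-mono-≤ (+-mono-≤ t+u≤φu t+u≤φu) (*-monoʳ-≤ 0≤u 2φ≤β+1)) p≤u)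
          (solve 5 (λ t u p f b → t :+ (t :+ p) :+ (f :* u :+ f :* u :+ (b :+ con 1) :* u :+ u) :=
             b :* u :+ (t :+ u :+ (t :+ u) :+ (f :+ f) :* u :+ p)) refl t u p φ β))
        (≤-trans (linear _ _ 0≤p (solve 2 (λ t p → t :+ (t :+ p) :+ p :=
             (con 1 :+ (con 1 :+ con 0)) :* (t :+ p) :+ con 0) refl t p))
          (*-monoʳ-≤ (+-nonNeg 0≤t 0≤p) 2≤β))
        where
        t+u≤φu : t + u ≤ φ * u
        t+u≤φu = φx≤y⇒x+y≤φy φt≤u

-- Mutual delays of jobs and the upper bound on the cost of the algorithm.

module Delays {c ℓ₁ ℓ₂} (ℝ : RealField c ℓ₁ ℓ₂) {φ β : RealField.Carrier ℝ}
  (balanced : Parameters.Balanced ℝ φ β)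
  {n k} (I : Scheduling.Instance ℝ n) (σ : Scheduling.Schedule ℝ n (suc k))
  (pcpm : Scheduling.PCPM ℝ φ β I σ) where

  open RealField ℝ hiding (zero)
  open Scheduling ℝ
  open OrderedField ℝ
  open Sums ℝ
  open Slots ℝ
  open Instance I
  open Run ℝ φ β I σ
  open Parameters.Balanced balanced
  open JobArithmetic ℝ balanced
  open Decimals ℝ using (double-half)

  -- The end of `final j` is the completion time of `j` in the schedule of the algorithm.
  first final : Fin n → Task n
  first = initialTask φ β I
  final j with first j
  ... | test _ = exec j
  ... | _      = untested j

  Tested Untested : Fin n → Set
  Tested j   = first j ≡ test j
  Untested j = first j ≡ untested j

  final-tested : ∀ {j} → Tested j → final j ≡ exec j
  final-tested eq rewrite eq = ≡.refl

  final-untested : ∀ {j} → Untested j → final j ≡ untested j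
  final-untested eq rewrite eq = ≡.refl

  kind : ∀ j → Tested j ⊎ Untested j
  kind j with φ * t j ≤? u j
  ... | yes _ = inj₁ ≡.refl
  ... | no  _ = inj₂ ≡.refl

  Tested⇒≤ : ∀ {j} → Tested j → φ * t j ≤ u j
  Tested⇒≤ {j} eq with φ * t j ≤? u j
  ... | yes h = h
  Tested⇒≤ {j} () | no _

  Untested⇒≰ : ∀ {j} → Untested j → ¬ φ * t j ≤ u j
  Untested⇒≰ {j} eq with φ * t j ≤? u j
  Untested⇒≰ {j} () | yes _
  ... | no h = h

  first-job : ∀ j → job (first j) ≡ j
  first-job j = [ ≡.cong job , ≡.cong job ]′ (kind j)

  Block : Task n → List (Task n)
  Block y = y ∷ follow y

  block-job : ∀ y {z} → z ∈ Block y → job z ≡ job y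
  block-job y            (here ≡.refl)         = ≡.refl
  block-job (test _)     (there (here ≡.refl)) = ≡.refl

  block-unique : ∀ y → Unique (Block y)
  block-unique (untested _) = [] ∷ []
  block-unique (test _)     = ((λ ()) ∷ []) ∷ [] ∷ []
  block-unique (exec _)     = [] ∷ []

  blocks-disjoint : ∀ {i j} → i ≢ j → List.Disjoint (Block (first i)) (Block (first j))
  blocks-disjoint {i} {j} i≢j (y∈i , y∈j) = i≢j (≡.trans (≡.sym (first-job i))
    (≡.trans (≡.sym (block-job (first i) y∈i)) (≡.trans (block-job (first j) y∈j) (first-job j))))

  allTasks : List (Task n)
  allTasks = expand (map first (allFin n))

  allTasks-unique : Unique allTasks
  allTasks-unique = Uniqueₚ.concat⁺
    (Allₚ.map⁺ (All.universal block-unique (map first (allFin n))))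
    (AllPairsₚ.map⁺ (AllPairsₚ.map⁺ (AllPairs.map blocks-disjoint (Uniqueₚ.allFin⁺ n))))

  block-∈ : ∀ j {z} → z ∈ Block (first j) → z ∈ allTasks
  block-∈ j z∈ = ∈ₚ.∈-concat⁺′ z∈ (∈ₚ.∈-map⁺ Block (∈ₚ.∈-map⁺ first (∈ₚ.∈-allFin j)))

  H : List (Task n)
  H = proj₁ (complete-history pcpm)

  history : History H
  history = proj₁ (proj₂ (complete-history pcpm))

  H-↭ : H ↭ allTasks
  H-↭ = proj₂ (proj₂ (complete-history pcpm))

  unique : Unique H
  unique = ↭ₛ.Unique-resp-↭ (≡.setoid (Task n)) (↭⇒↭ₛ (↭-sym H-↭)) allTasks-unique

  final∈H : ∀ j → final j ∈ H
  final∈H j = ↭ₚ.∈-resp-↭ (↭-sym H-↭) (block-∈ j (go (kind j)))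
    where
    go : Tested j ⊎ Untested j → final j ∈ Block (first j)
    go (inj₁ eq) rewrite eq = there (here ≡.refl)
    go (inj₂ eq) rewrite eq = here ≡.refl

  entry : ∀ {y K} → History K → (p : y ∈ K) → Entry (past p) y
  entry (e ∷ h) (here ≡.refl) = e
  entry (e ∷ h) (there p)     = entry h p

  past-history : ∀ {y K} → History K → (p : y ∈ K) → History (past p)
  past-history (e ∷ h) (here _)  = h
  past-history (e ∷ h) (there p) = past-history h p

  portion : Fin n → List (Task n) → Carrier
  portion i K = ∑ K (λ y → at (job y) (d y) i)

  -- An execution comes after its test, so a history without repetitions admits only these three
  -- states. In `full`, the weight of the final task serves as the total time spent on the job, `u`
  -- or `t + p`.
  data Portion (i : Fin n) (K : List (Task n)) : Set (c ⊔ ℓ₁) where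
    none : (∀ {y} → y ∈ K → job y ≢ i) → portion i K ≈ 0# → Portion i K
    part : Tested i → test i ∈ K → portion i K ≈ t i → Portion i K
    full : final i ∈ K → portion i K ≈ w (final i) → Portion i K

  tested-not-untested : ∀ {i} → Tested i → ¬ Untested i
  tested-not-untested eq eq′ = contradiction (≡.trans (≡.sym eq) eq′) λ ()

  exec-after-test : ∀ {i K} → History K → exec i ∈ K → test i ∈ K
  exec-after-test h e∈K with started-admissible h e∈K
  ... | exec _ t∈K = t∈K

  view : ∀ i {K} → History K → Unique K → Portion i K
  view i []      []          = none (λ ()) refl
  view i {y ∷ K} (e ∷ h) (y∉K ∷ uni) with job y Finₚ.≟ i
  ... | no job≢i = go (view i h uni)
    where
    skip : ∀ {x} → portion i K ≈ x → portion i (y ∷ K) ≈ x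
    skip eq = trans (+-cong (at-other (d y) job≢i) eq) (+-identityˡ _)
    go : Portion i K → Portion i (y ∷ K)
    go (none ∉K eq)     = none (λ { (here ≡.refl) → job≢i ; (there z∈) → ∉K z∈ }) (skip eq)
    go (part tst t∈ eq) = part tst (there t∈) (skip eq)
    go (full f∈ eq)     = full (there f∈) (skip eq)
  ... | yes ≡.refl = go (Entry.admissible e) (view i h uni) y∉K
    where
    go : ∀ {y} → Admissible K y → Portion (job y) K → All (y ≢_) K → Portion (job y) (y ∷ K)
    go (untested {j} eq) (none _ eq′) _ = full (here (final-untested eq))
      (trans (+-cong (at-self j (u j)) eq′) (trans (+-identityʳ _)
        (reflexive (≡.cong w (≡.sym (final-untested eq))))))
    go (untested eq) (part tst _ _) _ = contradiction eq (tested-not-untested tst)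
    go (untested eq) (full f∈ _) y∉ =
      contradiction ≡.refl (All.lookup y∉ (≡.subst (_∈ K) (final-untested eq) f∈))
    go (test {j} eq) (none _ eq′) _ = part eq (here ≡.refl)
      (trans (+-cong (at-self j (t j)) eq′) (+-identityʳ _))
    go (test eq) (part _ t∈ _) y∉ = contradiction ≡.refl (All.lookup y∉ t∈)
    go (test eq) (full f∈ _) y∉ = contradiction ≡.refl
      (All.lookup y∉ (exec-after-test h (≡.subst (_∈ K) (final-tested eq) f∈)))
    go (exec eq t∈) (none ∉K _) _ = contradiction ≡.refl (∉K t∈)
    go (exec {j} eq _) (part _ _ eq′) _ = full (here (final-tested eq))
      (trans (+-cong (at-self j (p j)) eq′) (trans (+-comm _ _)
        (reflexive (≡.cong w (≡.sym (final-tested eq))))))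
    go (exec eq _) (full f∈ _) y∉ =
      contradiction ≡.refl (All.lookup y∉ (≡.subst (_∈ K) (final-tested eq) f∈))

  M : Carrier
  M = fromℕ (suc k)

  x≤Mx : ∀ {x} → 0# ≤ x → x ≤ M * x
  x≤Mx 0≤x = ≤-respˡ-≈ (*-identityˡ _) (*-monoʳ-≤ 0≤x (x≤x+y 1# (fromℕ-nonNeg k)))

  C : Fin n → Carrier
  C = completion I σ

  q : Fin n → Carrier
  q = size I

  -- The start of job j can be charged to the tasks started before its
  -- `marker`: its final task, unless this is an execution task that was
  -- started immediately after the test, in which case it is the test.
  record Marker (j : Fin n) : Set (c ⊔ ℓ₁ ⊔ ℓ₂) where
    field
      {marker} : Task n
      started  : marker ∈ H
      isMarker : marker ≡ final j ⊎ (Tested j × marker ≡ test j)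
      lighter  : All (λ z → w z ≤ w marker) (past started)
      rank-≤   : rank started ℕ.≤ rank (final∈H j)
      charged  : M * C j + portion j (past started) ≤ M * w (final j) + ∑ (past started) d

  scheduled-untested : ∀ {j s} → Scheduled σ (untested j) s → C j ≡ startOf σ (untested j) + u j
  scheduled-untested (untested eq) = completion-untested I σ eq

  scheduled-exec : ∀ {j s} → Scheduled σ (exec j) s → C j ≡ startOf σ (exec j) + p j
  scheduled-exec (exec eq) = completion-tested I σ eq

  test∉past : ∀ {j} (r : test j ∈ H) → test j ∉ past r
  test∉past r t∈ = ℕₚ.<-irrefl ≡.refl (rank-past unique r t∈ r)

  final∉past : ∀ {j y} (r : y ∈ H) → y ≡ final j → final j ∉ past r
  final∉past r ≡.refl f∈ = ℕₚ.<-irrefl ≡.refl (rank-past unique r f∈ r)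

  early-start : ∀ {y K} → Entry K y → ¬ Immediate y → Early K y
  early-start e ¬imm with Entry.timely e
  ... | inj₁ early = early
  ... | inj₂ imm   = contradiction imm ¬imm

  charge : ∀ {x b s S} → x ≤ b + M * s → M * s ≤ S → x ≤ b + S
  charge h₁ h₂ = ≤-trans h₁ (+-monoʳ-≤ _ h₂)

  -- If the execution of a tested job is early, `M * C j` counts only `p j` after the start, and the
  -- surplus `M * t j` on the right pays for the job's own test in the past. If it is immediate, the
  -- start is traced back to that of the test, which is always early and has no work of `j` before
  -- it.
  mark : ∀ j → Marker j
  mark j = [ mark-tested , mark-untested ]′ (kind j)
    where
    f : final j ∈ H
    f = final∈H j

    mark-untested : Untested j → Marker j
    mark-untested eq = record
      { started  = f
      ; isMarker = inj₁ ≡.refl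
      ; lighter  = proj₁ early
      ; rank-≤   = ℕₚ.≤-refl
      ; charged  = charge C-≤ (proj₂ early)
      }
      where
      e : Entry (past f) (final j)
      e = entry history f
      not-immediate : ∀ {y} → y ≡ untested j → ¬ Immediate y
      not-immediate ≡.refl ()
      early : Early (past f) (final j)
      early = early-start e (not-immediate (final-untested eq))
      portion-zero : Portion j (past f) → portion j (past f) ≈ 0#
      portion-zero (none _ eq′)   = eq′
      portion-zero (part tst _ _) = contradiction eq (tested-not-untested tst)
      portion-zero (full f∈ _)    = contradiction f∈ (final∉past f ≡.refl)
      C≡ : ∀ {y} → y ≡ untested j → Scheduled σ y (slotOf σ y) → C j ≡ startOf σ y + w y
      C≡ ≡.refl sch = scheduled-untested sch
      C-≤ : M * C j + portion j (past f) ≤ M * w (final j) + M * startOf σ (final j)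
      C-≤ = ≤-reflexive (trans
        (+-cong (*-congˡ (reflexive (C≡ (final-untested eq) (Entry.scheduled e))))
          (portion-zero (view j (past-history history f) (past-unique unique f))))
        (solve 3 (λ m s w → m :* (s :+ w) :+ con 0 := m :* w :+ m :* s) refl
          M (startOf σ (final j)) (w (final j))))

    mark-tested : Tested j → Marker j
    mark-tested eq = go (Entry.timely e)
      where
      f′ : exec j ∈ H
      f′ = ≡.subst (_∈ H) (final-tested eq) f
      rank-f′ : rank f′ ≡ rank f
      rank-f′ = lemma (final-tested eq) f
        where
        lemma : ∀ {y z} (eq : y ≡ z) (r : y ∈ H) → rank (≡.subst (_∈ H) eq r) ≡ rank r
        lemma ≡.refl r = ≡.refl
      e : Entry (past f′) (exec j)
      e = entry history f′
      test∈past : test j ∈ past f′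
      test∈past with Entry.admissible e
      ... | exec _ t∈ = t∈
      r : test j ∈ H
      r = past-⊆ f′ test∈past
      w-final : w (final j) ≈ t j + p j
      w-final = reflexive (≡.cong w (final-tested eq))
      go : Early (past f′) (exec j) ⊎ Immediate (exec j) → Marker j
      go (inj₁ early) = record
        { started  = f′
        ; isMarker = inj₁ (≡.sym (final-tested eq))
        ; lighter  = proj₁ early
        ; rank-≤   = ℕₚ.≤-reflexive rank-f′
        ; charged  = charge C-≤ (proj₂ early)
        }
        where
        portion-≤ : Portion j (past f′) → portion j (past f′) ≤ M * t j
        portion-≤ (none ∉K _)    = contradiction ≡.refl (∉K test∈past)
        portion-≤ (part _ _ eq′) = ≤-respˡ-≈ (sym eq′) (x≤Mx (0≤t j))
        portion-≤ (full f∈ _)    = contradiction f∈ (final∉past f′ (≡.sym (final-tested eq)))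
        C-≤ : M * C j + portion j (past f′) ≤ M * w (final j) + M * startOf σ (exec j)
        C-≤ = ≤-respˡ-≈ (+-congʳ (*-congˡ (reflexive (≡.sym (scheduled-exec (Entry.scheduled e))))))
          (≤-trans (+-monoʳ-≤ _ (portion-≤ (view j (past-history history f′) (past-unique unique f′))))
            (≤-reflexive (trans
              (solve 4 (λ m s t p → m :* (s :+ p) :+ m :* t := m :* (t :+ p) :+ m :* s) refl
                M (startOf σ (exec j)) (t j) (p j))
              (+-congʳ (*-congˡ (sym w-final))))))
      go (inj₂ (exec start≈)) = record
        { started  = r
        ; isMarker = inj₂ (eq , ≡.refl)
        ; lighter  = proj₁ early
        ; rank-≤   = ℕₚ.<⇒≤ (≡.subst (rank r ℕ.<_) rank-f′ (rank-past unique f′ test∈past r))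
        ; charged  = charge C-≤ (proj₂ early)
        }
        where
        early : Early (past r) (test j)
        early = early-start (entry history r) λ ()
        portion-zero : Portion j (past r) → portion j (past r) ≈ 0#
        portion-zero (none _ eq′)  = eq′
        portion-zero (part _ t∈ _) = contradiction t∈ (test∉past r)
        portion-zero (full f∈ _)   = contradiction
          (exec-after-test (past-history history r) (≡.subst (_∈ past r) (final-tested eq) f∈)) (test∉past r)
        C-≤ : M * C j + portion j (past r) ≤ M * w (final j) + M * startOf σ (test j)
        C-≤ = ≤-reflexive (trans
          (+-cong (*-congˡ (trans (reflexive (scheduled-exec (Entry.scheduled e))) (+-congʳ start≈)))
            (portion-zero (view j (past-history history r) (past-unique unique r))))
          (trans
            (solve 4 (λ m s t p → m :* (s :+ t :+ p) :+ con 0 := m :* (t :+ p) :+ m :* s) refl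
              M (startOf σ (test j)) (t j) (p j))
            (+-congʳ (*-congˡ (sym w-final)))))

  module Mark j = Marker (mark j)
  open Mark using (marker; started; isMarker; lighter; rank-≤; charged)

  earlier : Fin n → List (Task n)
  earlier j = past (started j)

  final-≤ : ∀ j → w (final j) ≤ φ * q j
  final-≤ j = [ (λ eq → ≤-respˡ-≈ (reflexive (≡.cong w (≡.sym (final-tested eq))))
                  (tested-≤ (0≤t j) (0≤u j) (0≤p j) (p≤u j) (Tested⇒≤ eq)))
              , (λ eq → ≤-respˡ-≈ (reflexive (≡.cong w (≡.sym (final-untested eq))))
                  (untested-≤ (0≤t j) (0≤u j) (0≤p j) (p≤u j) (Untested⇒≰ eq))) ]′ (kind j)

  t≤q : ∀ {j} → Tested j → t j ≤ q j
  t≤q {j} eq = test-≤ (0≤t j) (0≤u j) (0≤p j) (p≤u j) (Tested⇒≤ eq)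

  t≤final : ∀ {j} → Tested j → t j ≤ w (final j)
  t≤final {j} eq = ≤-respʳ-≈ (reflexive (≡.cong w (≡.sym (final-tested eq)))) (x≤x+y (t j) (0≤p j))

  t+final-≤ : ∀ {j} → Tested j → t j + w (final j) ≤ β * q j
  t+final-≤ {j} eq = ≤-respˡ-≈ (+-congˡ (reflexive (≡.cong w (≡.sym (final-tested eq)))))
    (test+tested-≤ (0≤t j) (0≤u j) (0≤p j) (p≤u j) (Tested⇒≤ eq))

  φq≤βq : ∀ j → φ * q j ≤ β * q j
  φq≤βq j = *-monoʳ-≤ (size-nonNeg I j) φ≤β

  marker-≤ : ∀ j → w (marker j) ≤ β * q j
  marker-≤ j = go (isMarker j)
    where
    go : marker j ≡ final j ⊎ (Tested j × marker j ≡ test j) → w (marker j) ≤ β * q j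
    go (inj₁ eq) = ≤-respˡ-≈ (reflexive (≡.cong w (≡.sym eq))) (≤-trans (final-≤ j) (φq≤βq j))
    go (inj₂ (tst , eq)) = ≤-respˡ-≈ (reflexive (≡.cong w (≡.sym eq))) (*-monoˡ-≤ 0≤β (t≤q tst))

  -- A bound by the size of `i` alone suffices, since the left side is symmetric. It rests on the
  -- fact that tasks of `j` started before the marker of `i` are no heavier than this marker.
  mutual-delay : ∀ i j → portion i (earlier j) + portion j (earlier i) ≤ β * q i
  mutual-delay i j = go (view-earlier i j) (view-earlier j i) (isMarker i)
    where
    view-earlier : ∀ i j → Portion i (earlier j)
    view-earlier i j = view i (past-history history (started j)) (past-unique unique (started j))

    0≤βq : 0# ≤ β * q i
    0≤βq = *-nonNeg 0≤β (size-nonNeg I i)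

    earlier-≤ : ∀ {z y} → z ∈ earlier i → marker i ≡ y → w z ≤ w y
    earlier-≤ z∈ ≡.refl = All.lookup (lighter i) z∈

    both : ∀ {a b x y} → a ≈ x → b ≈ y → x + y ≤ β * q i → a + b ≤ β * q i
    both a≈ b≈ = ≤-respˡ-≈ (sym (+-cong a≈ b≈))

    -- `y` starts before the marker of `j`, which is not after `final j`, which starts before the
    -- marker of `i`. The resulting cycles exclude the last two cases of `go`.
    ordered : ∀ {y} → y ∈ earlier j → final j ∈ earlier i → (r : y ∈ H) → rank r ℕ.< rank (started i)
    ordered y∈ f∈ r = ℕₚ.<-trans (rank-past unique (started j) y∈ r)
      (ℕₚ.≤-<-trans (rank-≤ j) (rank-past unique (started i) f∈ (final∈H j)))

    go : Portion i (earlier j) → Portion j (earlier i) →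
         marker i ≡ final i ⊎ (Tested i × marker i ≡ test i) →
         portion i (earlier j) + portion j (earlier i) ≤ β * q i
    go (none _ a≈) (none _ b≈) _ = both a≈ b≈ (≤-respˡ-≈ (sym (+-identityˡ 0#)) 0≤βq)
    go (none _ a≈) (part tst t∈ b≈) _ = both a≈ b≈ (≤-respˡ-≈ (sym (+-identityˡ _))
      (≤-trans (x≤βx (0≤t j)) (≤-trans (earlier-≤ t∈ ≡.refl) (marker-≤ i))))
    go (none _ a≈) (full f∈ b≈) _ = both a≈ b≈ (≤-respˡ-≈ (sym (+-identityˡ _))
      (≤-trans (earlier-≤ f∈ ≡.refl) (marker-≤ i)))
    go (part tst _ a≈) (none _ b≈) _ = both a≈ b≈ (≤-respˡ-≈ (sym (+-identityʳ _))
      (≤-trans (t≤q tst) (x≤βx (size-nonNeg I i))))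
    go (full _ a≈) (none _ b≈) _ = both a≈ b≈ (≤-respˡ-≈ (sym (+-identityʳ _))
      (≤-trans (final-≤ i) (φq≤βq i)))
    go (part tst _ a≈) (part _ t∈ b≈) (inj₁ eq) = both a≈ b≈
      (≤-trans (+-monoˡ-≤ _ (t≤final tst)) (combined-≤ (final-≤ i) (earlier-≤ t∈ eq)))
    -- Test weights carry the same factor `β`, so the test of `j` is no longer than that of `i`.
    go (part tst _ a≈) (part _ t∈ b≈) (inj₂ (_ , eq)) = both a≈ b≈
      (≤-trans (+-monoʳ-≤ _ (≤-trans (*-cancelˡ-≤ 0<β (earlier-≤ t∈ eq)) (t≤final tst))) (t+final-≤ tst))
    -- The critical case: all of `i` precedes the marker of `j`, while the test of `j`, of weight
    -- `β * t j`, precedes `final i` and is no heavier.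
    go (full _ a≈) (part _ t∈ b≈) (inj₁ eq) = both a≈ b≈ (combined-≤ (final-≤ i) (earlier-≤ t∈ eq))
    go (full _ a≈) (part _ t∈ b≈) (inj₂ (tst , eq)) = both a≈ b≈
      (≤-trans (+-monoʳ-≤ _ (*-cancelˡ-≤ 0<β (earlier-≤ t∈ eq)))
        (≤-respˡ-≈ (+-comm _ _) (t+final-≤ tst)))
    -- The whole work of `j` equals the weight of `final j`, so it is at most `w (final i)`.
    go (part tst _ a≈) (full f∈ b≈) (inj₁ eq) = both a≈ b≈
      (≤-trans (+-monoʳ-≤ _ (earlier-≤ f∈ eq)) (t+final-≤ tst))
    go (part _ t∈ _) (full f∈ _) (inj₂ (_ , eq)) = contradiction
      (ordered (≡.subst (_∈ earlier j) (≡.sym eq) t∈) f∈ (started i)) (ℕₚ.<-irrefl ≡.refl)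
    go (full f∈ _) (full f∈′ _) _ = contradiction
      (ℕₚ.<-≤-trans (ordered f∈ f∈′ (final∈H i)) (rank-≤ i)) (ℕₚ.<-irrefl ≡.refl)

  2M*cost-≤ : M * cost I σ + M * cost I σ ≤
    (φ + φ) * (fromℕ k * sum q) + β * sum q + β * sum (λ i → sum (λ j → q i ⊓ q j))
  2M*cost-≤ = begin
    M * cost I σ + M * cost I σ
      ≤⟨ +-mono-≤ M*cost-≤ M*cost-≤ ⟩
    φ * (fromℕ k * sum q) + sum half + sum (λ j → sum (delay j)) +
    (φ * (fromℕ k * sum q) + sum half + sum (λ j → sum (delay j)))
      ≈⟨ solve 4 (λ f s h d → f :* s :+ h :+ d :+ (f :* s :+ h :+ d) :=
           (f :+ f) :* s :+ (h :+ h) :+ (d :+ d)) refl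
           φ (fromℕ k * sum q) (sum half) (sum (λ j → sum (delay j))) ⟩
    (φ + φ) * (fromℕ k * sum q) + (sum half + sum half) +
    (sum (λ j → sum (delay j)) + sum (λ j → sum (delay j)))
      ≤⟨ +-mono-≤ (+-monoʳ-≤ _ (≤-reflexive halves)) delays ⟩
    (φ + φ) * (fromℕ k * sum q) + β * sum q + β * sum (λ i → sum (λ j → q i ⊓ q j)) ∎
    where
    open ≤R

    half : Fin n → Carrier
    half j = β * q j / fromℕ 2

    halves : sum half + sum half ≈ β * sum q
    halves = trans (sym (∑-distrib-+ {n} half half))
      (trans (sum-cong-≋ {n} (λ j → double-half (β * q j))) (sym (*-distribˡ-sum {n} β q)))

    -- The diagonal is chosen so that `delay j i + delay i j` is at most
    -- β times the smaller size for all i and j.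
    delay : Fin n → Fin n → Carrier
    delay j i with i Finₚ.≟ j
    ... | yes _ = half j
    ... | no  _ = portion i (earlier j)

    delay-≤ : ∀ i j → delay j i + delay i j ≤ β * (q i ⊓ q j)
    delay-≤ i j with i Finₚ.≟ j | j Finₚ.≟ i
    ... | yes ≡.refl | yes _ = ≤-respˡ-≈ (sym (double-half _)) (*-glb-⊓ ≤-refl ≤-refl)
    ... | yes i≡j | no j≢i = contradiction (≡.sym i≡j) j≢i
    ... | no i≢j | yes j≡i = contradiction (≡.sym j≡i) i≢j
    ... | no _ | no _ = *-glb-⊓ (mutual-delay i j) (≤-respˡ-≈ (+-comm _ _) (mutual-delay j i))

    delays : sum (λ j → sum (delay j)) + sum (λ j → sum (delay j)) ≤
             β * sum (λ i → sum (λ j → q i ⊓ q j))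
    delays = begin
      sum (λ j → sum (delay j)) + sum (λ j → sum (delay j))
        ≈⟨ +-congʳ (∑-comm {n} {n} delay) ⟩
      sum (λ i → sum (λ j → delay j i)) + sum (λ i → sum (delay i))
        ≈⟨ ∑-distrib-+ {n} _ _ ⟨
      sum (λ i → sum (λ j → delay j i) + sum (delay i))
        ≈⟨ sum-cong-≋ {n} (λ i → ∑-distrib-+ {n} (λ j → delay j i) (delay i)) ⟨
      sum (λ i → sum (λ j → delay j i + delay i j))
        ≤⟨ sum-mono-≤ (λ i → sum-mono-≤ (delay-≤ i)) ⟩
      sum (λ i → sum (λ j → β * (q i ⊓ q j)))
        ≈⟨ sum-cong-≋ {n} (λ i → *-distribˡ-sum {n} β (λ j → q i ⊓ q j)) ⟨
      sum (λ i → β * sum (λ j → q i ⊓ q j))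
        ≈⟨ *-distribˡ-sum {n} β _ ⟨
      β * sum (λ i → sum (λ j → q i ⊓ q j)) ∎

    -- Exchanges the job's own portion, the diagonal term when the past is split by jobs, for the
    -- diagonal term `half j` of `delay`.
    work-≤ : ∀ j → ∑ (earlier j) d + half j ≤ portion j (earlier j) + sum (delay j)
    work-≤ j = begin
      ∑ (earlier j) d + half j
        ≈⟨ +-cong (∑-group (earlier j) job d) (sym (sum-at j (half j))) ⟩
      sum (λ i → portion i (earlier j)) + sum (at j (half j))
        ≈⟨ ∑-distrib-+ {n} _ _ ⟨
      sum (λ i → portion i (earlier j) + at j (half j) i)
        ≤⟨ sum-mono-≤ pointwise ⟩
      sum (λ i → at j (portion j (earlier j)) i + delay j i)
        ≈⟨ ∑-distrib-+ {n} _ _ ⟩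
      sum (at j (portion j (earlier j))) + sum (delay j)
        ≈⟨ +-congʳ (sum-at j _) ⟩
      portion j (earlier j) + sum (delay j) ∎
      where
      pointwise : ∀ i → portion i (earlier j) + at j (half j) i ≤
                        at j (portion j (earlier j)) i + delay j i
      pointwise i with i Finₚ.≟ j
      ... | yes ≡.refl = ≤-reflexive (+-cong (sym (at-self j _)) (at-self j (half j)))
      ... | no i≢j = ≤-reflexive (trans (+-congˡ (at-other (half j) (i≢j ∘ ≡.sym)))
        (trans (+-comm _ _) (+-congʳ (sym (at-other _ (i≢j ∘ ≡.sym))))))

    -- The job's own portion cancels between `charged` and `work-≤`. Of the `M` copies of
    -- `w (final j)`, `k` are bounded by `φ * q j` each and the last one by two halves, one of which
    -- is used up by the diagonal of `delay`.
    C-≤ : ∀ j → M * C j ≤ φ * (fromℕ k * q j) + half j + sum (delay j)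
    C-≤ j = linear _ _ (+-mono-≤ (+-mono-≤ (charged j) (work-≤ j))
        (+-mono-≤ (*-monoˡ-≤ (fromℕ-nonNeg k) (final-≤ j)) final-≤-halves))
      (solve 9 (λ c r a k s h r′ D f →
          c :+ ((con 1 :+ k) :* a :+ s :+ (r :+ D) :+ (k :* (f :* r′) :+ (h :+ h))) :=
          f :* (k :* r′) :+ h :+ D :+ (c :+ r :+ (s :+ h) :+ (k :* a :+ a))) refl
        (M * C j) (portion j (earlier j)) (w (final j)) (fromℕ k) (∑ (earlier j) d) (half j)
        (q j) (sum (delay j)) φ)
      where
      final-≤-halves : w (final j) ≤ half j + half j
      final-≤-halves = ≤-respʳ-≈ (sym (double-half _)) (≤-trans (final-≤ j) (φq≤βq j))

    M*cost-≤ : M * cost I σ ≤ φ * (fromℕ k * sum q) + sum half + sum (λ j → sum (delay j))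
    M*cost-≤ = begin
      M * sum C
        ≈⟨ *-distribˡ-sum {n} M C ⟩
      sum (λ j → M * C j)
        ≤⟨ sum-mono-≤ C-≤ ⟩
      sum (λ j → φ * (fromℕ k * q j) + half j + sum (delay j))
        ≈⟨ ∑-distrib-+ {n} _ _ ⟩
      sum (λ j → φ * (fromℕ k * q j) + half j) + sum (λ j → sum (delay j))
        ≈⟨ +-congʳ (∑-distrib-+ {n} _ half) ⟩
      sum (λ j → φ * (fromℕ k * q j)) + sum half + sum (λ j → sum (delay j))
        ≈⟨ +-congʳ (+-congʳ (trans (*-congˡ (*-distribˡ-sum {n} (fromℕ k) q)) (*-distribˡ-sum {n} φ _))) ⟨
      φ * (fromℕ k * sum q) + sum half + sum (λ j → sum (delay j)) ∎

-- Combination of the two bounds.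

module Main {c ℓ₁ ℓ₂} (ℝ : RealField c ℓ₁ ℓ₂) where
  open RealField ℝ hiding (zero)
  open Analysis ℝ
  open Scheduling ℝ
  open OrderedField ℝ
  open Sums ℝ
  open Slots ℝ
  open Constants ℝ

  -- Expansion of `0 ≤ (y - x) (v - u)`.
  cross-≤ : ∀ {x y u v} → x ≤ y → u ≤ v → x * v + y * u ≤ x * u + y * v
  cross-≤ {x} {y} {u} {v} x≤y u≤v = linear _ _
    (*-nonNeg (x≤y⇒0≤y-x x≤y) (x≤y⇒0≤y-x u≤v)) (begin
      x * v + y * u + (y - x) * (v - u)
        ≈⟨ +-congʳ (+-cong (*-congˡ (sym (x-y+y≈x v u))) (*-congʳ (sym (x-y+y≈x y x)))) ⟩
      x * (v - u + u) + (y - x + x) * u + (y - x) * (v - u)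
        ≈⟨ solve 4 (λ x u a b → x :* (b :+ u) :+ (a :+ x) :* u :+ a :* b :=
             x :* u :+ (a :+ x) :* (b :+ u) :+ con 0) refl x u (y - x) (v - u) ⟩
      x * u + (y - x + x) * (v - u + u) + 0#
        ≈⟨ +-congʳ (+-congˡ (*-cong (x-y+y≈x y x) (x-y+y≈x v u))) ⟩
      x * u + y * v + 0# ∎)
    where open SetoidReasoning setoid

  module _ (√5 : Carrier) (√5-sqrt : IsSqrt (fromℕ 5) √5)
    (r : Carrier) (r-sqrt : IsSqrt (fromℕ 5 * Golden.φ √5 √5-sqrt + 1#) r) where

    open Golden √5 √5-sqrt
    open Ratio r r-sqrt

    balanced : Parameters.Balanced ℝ φ β
    balanced = record
      { 1≤φ = 1≤φ ; φ² = φ² ; β² = β² ; 2≤β = 2≤β ; φ≤β = φ≤β ; 2φ≤β+1 = 2φ≤β+1 }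

    competitive : ∀ m → .{{NonZero m}} →
      CompetitiveRatioAtMost {m} (bound m) (PCPM φ β)
    competitive zero {{()}}
    competitive (suc k) {n} I σ opt pcpm (feasible , _) =
      *-cancelˡ-≤ 0<2M (≤-respʳ-≈ bound≈ (linear _ _
        (+-mono-≤ (+-mono-≤ alg-≤ (*-monoˡ-≤ 0≤β LB.cost-≥))
          -- Eliminating `E` leaves the term `(2φ - β) k P`. Its coefficient is nonnegative, so `P`
          -- may be replaced by the optimal cost; `cross-≤` states this without subtraction.
          (cross-≤ β≤2φ (*-monoˡ-≤ (fromℕ-nonNeg k) LB.size≤cost)))
        (solve 7 (λ a b f k p e o →
            (con 1 :+ k :+ (con 1 :+ k)) :* a :+
              ((f :+ f) :* (k :* p) :+ b :* p :+ b :* e :+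
                b :* ((con 1 :+ k) :* o :+ (con 1 :+ k) :* o) :+
                (b :* (k :* p) :+ (f :+ f) :* (k :* o))) :=
            (b :* ((con 1 :+ k) :+ con 1) :+ (f :+ f) :* k) :* o :+
              ((con 1 :+ k) :* a :+ (con 1 :+ k) :* a :+ b :* (e :+ (con 1 :+ k) :* p) :+
                (b :* (k :* o) :+ (f :+ f) :* (k :* p)))) refl
          (cost I σ) β φ (fromℕ k) P E (cost I opt))))
      where
      module LB = LowerBound ℝ I opt feasible
      M P E : Carrier
      M = fromℕ (suc k)
      P = sum (size I)
      E = sum (λ i → sum (λ j → size I i ⊓ size I j))
      0<2M : 0# < M + M
      0<2M = <-≤-trans (fromℕ-pos k) (x≤x+y M (fromℕ-nonNeg (suc k)))
      alg-≤ : M * cost I σ + M * cost I σ ≤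
              (φ + φ) * (fromℕ k * P) + β * P + β * E
      alg-≤ = Delays.2M*cost-≤ ℝ balanced I σ pcpm
      bound≈ : (β * (M + 1#) + (φ + φ) * fromℕ k) * cost I opt ≈
               (M + M) * (bound (suc k) * cost I opt)
      bound≈ = trans (*-congʳ (sym (2M*bound k))) (*-assoc _ _ _)

corollary20 : ∀ {c ℓ₁ ℓ₂} (ℝ : RealField c ℓ₁ ℓ₂) →
    let open RealField ℝ
        open Analysis ℝ
        open Scheduling ℝ in
    ∀ √5 → IsSqrt (fromℕ 5) √5 →
    let φ = (1# + √5) / fromℕ 2 in
    ∀ √[5φ+1] → IsSqrt (fromℕ 5 * φ + 1#) √[5φ+1] →
    let β = (φ + √[5φ+1]) / fromℕ 2
        bound : ℕ → Carrier
        bound m = β * (1# / fromℕ 2 + 1# / (fromℕ 2 * fromℕ m)) + φ * (1# - 1# / fromℕ m) in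
    β ≤ decimal 2 (3 ∷ 1 ∷ 6 ∷ 5 ∷ 2 ∷ []) ×
    (∀ m → .{{NonZero m}} → CompetitiveRatioAtMost {m} (bound m) (PCPM φ β)) ×
    (∃ λ L → TendsTo bound L × L ≤ decimal 2 (7 ∷ 7 ∷ 6 ∷ 3 ∷ 0 ∷ []))
corollary20 ℝ √5 √5-sqrt r r-sqrt =
  β≤2·31652 , Main.competitive ℝ √5 √5-sqrt r r-sqrt ,
  limit , bound-tendsTo , limit≤2·77630
  where open Constants.Golden.Ratio ℝ √5 √5-sqrt r r-sqrt
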